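{- Let $m,n$ be integers with $m\ge 4$ and $n\ge m+5$ (so that $S=\{2,m,m+2,n-1\}$ is $n$-admissible), and define $p(S;n)$ by $\#P(S;n)=p(S;n)\,2^{n-5}$. Then $$2p(S;n)=(m-3)(n-m-4)\Big[m\binom{n-1}{m+1}+(n-m-1)\binom{n-1}{m-1}\Big]+(n-1)\Big[m(m-3)\binom{n-2}{m+1}+(n-m-1)(n-m-4)\binom{n-2}{m-2}-2(n-6)\binom{n-4}{m-1}-2(n-6)\binom{n-4}{m-2}+4\binom{n-4}{1}\Big].$$
   Context: For a permutation $\pi=a_1\ldots a_n$ of $\{1,\ldots,n\}$, an index $i$ is a peak if $a_{i-1}<a_i>a_{i+1}$. $P(S;n)$ is the set of permutations of $\{1,\dots,n\}$ whose set of peaks is exactly $S$. -}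

module Defs where

open import Data.Nat using (ℕ; zero; suc; _+_; _*_; _∸_; _<ᵇ_)
open import Data.Bool using (Bool; true; false; _∧_; if_then_else_)
open import Data.List using (List; []; _∷_; map; concatMap; length; filter; upTo)
open import Data.List.Properties using (≡-dec)
open import Data.Nat.Properties using (_≟_)
open import Relation.Nullary.Decidable using (does)
open import Relation.Unary using (Pred)

insertions : ℕ → List ℕ → List (List ℕ)
insertions x [] = (x ∷ []) ∷ []
insertions x (y ∷ ys) = (x ∷ y ∷ ys) ∷ map (y ∷_) (insertions x ys)

-- All permutations of a list (each listed exactly once when entries are distinct).
perms : List ℕ → List (List ℕ)
perms [] = [] ∷ []
perms (x ∷ xs) = concatMap (insertions x) (perms xs)

oneTo : ℕ → List ℕ
oneTo n = map suc (upTo n)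

Perm : ℕ → List (List ℕ)
Perm n = perms (oneTo n)

-- Peaks of a word a₁…aₙ, as the increasing list of (1-based) indices i
-- with a_{i-1} < a_i > a_{i+1}.  The argument k is the 1-based index of
-- the middle letter of the current window.
peaksFrom : ℕ → List ℕ → List ℕ
peaksFrom k (a ∷ b ∷ c ∷ rest) =
  if (a <ᵇ b) ∧ (c <ᵇ b)
  then k ∷ peaksFrom (suc k) (b ∷ c ∷ rest)
  else peaksFrom (suc k) (b ∷ c ∷ rest)
peaksFrom k _ = []

peaks : List ℕ → List ℕ
peaks w = peaksFrom 2 w

-- #P(S;n) for S given as a strictly increasing list of indices:
-- number of permutations of {1..n} whose peak set is exactly S.
#P : List ℕ → ℕ → ℕ
#P S n = length (filter (λ w → ≡-dec _≟_ (peaks w) S) (Perm n))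

{-# OPTIONS --safe #-}

-- Let c(S; n) = #P(S; n). Choosing which values occupy the first k positions and ordering the two parts
-- independently counts the words whose two parts have prescribed peak sets S₁ and S₂. Joining the parts
-- creates a peak at k, or at k+1, or none, so
--   C(n,k) c(S₁; k) c(S₂; n−k) = c(S₁ ∪ S₂′; n) + c(S₁ ∪ {k} ∪ S₂′; n) + c(S₁ ∪ {k+1} ∪ S₂′; n),   S₂′ = S₂ + k.
-- With c(∅; n) = 2ⁿ⁻¹ this yields c({2}; n), c({n−1}; n), c({2,n−1}; n), and, by recursion on k starting from
-- c({2,3,n−1}; n) = 0, a closed form of c({2,k,n−1}; n). For S₁ = {2,m}, S₂ = {n−m−2} and k = m+1 the middle
-- term vanishes, which expresses c({2,m,m+2,n−1}; n) through counts already known; what remains is a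
-- binomial identity.

module Submission where

open import Defs
open import Data.Nat using (ℕ; _≤_; _∸_)
open import Data.Nat as ℕ using ()
open import Data.Nat.Combinatorics using (_C_)
open import Data.List using (List; []; _∷_)
open import Relation.Binary.PropositionalEquality using (_≡_)

open import Data.Bool using (true; false; if_then_else_; T; _∧_)
open import Data.List using (_++_; map; concatMap; length; filter; upTo; applyUpTo; take; drop)
open import Data.List.Properties using (≡-dec; ∷-injective; ∷-injectiveˡ; ∷-injectiveʳ; map-injective; map-applyUpTo; map-concatMap; map-∘; concatMap-cong; concatMap-map; length-map; length-take; length-upTo; take++drop≡id)
open import Data.List.Relation.Binary.Permutation.Propositional using (_↭_; prep; swap; ↭-refl; ↭-sym; ↭-trans; ↭⇒↭ₛ)
open import Data.List.Relation.Binary.Permutation.Propositional.Properties using (All-resp-↭; ↭-length)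
open import Data.List.Relation.Unary.All as All using (All; []; _∷_)
import Data.List.Relation.Unary.All.Properties as Allₚ
open import Data.List.Relation.Unary.AllPairs as AllPairs using (AllPairs; []; _∷_)
import Data.List.Relation.Unary.AllPairs.Properties as AllPairsₚ
open import Data.List.Relation.Unary.Linked using (Linked; []; [-]; _∷_)
open import Data.Nat using (zero; suc; z≤n; s≤s)
open import Data.Nat.Combinatorics using (k![n∸k]!∣n!; nC1≡n; nCk≡nC[n∸k]; nCk≡n!/k![n-k]!; nCk+nC[k+1]≡[n+1]C[k+1])
open import Data.Nat.DivMod using (m/n*n≡m)
import Data.Nat.Properties as ℕₚ
open import Data.Nat.Properties using (_≟_; _!*_!≢0)
open import Data.Nat.Tactic.RingSolver using () renaming (solve-∀ to ℕ-solve-∀)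
open import Data.Product using (∃; _×_; _,_; proj₁; proj₂)
open import Data.Unit using (tt)
open import Function using (_∘_; id; case_of_)
open import Relation.Binary using (tri<; tri≈; tri>; _Respects₂_)
open import Relation.Binary.PropositionalEquality using (_≢_; refl; sym; trans; cong; cong₂; subst; ≢-sym; setoid; module ≡-Reasoning)
open import Data.List.Relation.Binary.Permutation.Setoid.Properties (setoid ℕ) using (AllPairs-resp-↭)
open import Relation.Nullary using (¬_; yes; no; contradiction)
open import Relation.Nullary.Decidable using (does; dec-true; dec-false)

-- The cut identity is proved for a single word `u ++ v`, as an equation between indicator
-- functions. Summing it over all words meets two obstacles. `perms` inserts the head of the list
-- into permutations of the tail, so the prefix of a word is not visible to its recursion, and an
-- induction over insertions is required. Moreover, the letters of a prefix form an arbitrary set,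
-- so peak counts must be shown to depend only on the number of letters. The middle term at
-- `k = m + 1` vanishes because `m` and `m + 1` would be neighbouring peaks; for the same reason the
-- recursion on `k` can start from 0 at `{2, 3, n−1}`. Solving the cut identity for one count brings
-- in negative terms. Every counting identity is therefore stated over ℕ with these terms moved to
-- the other side. The final computation uses `a = m − 4`, `b = n − m − 5` and `s = n − 9`, which
-- turn all differences in the formula into sums. Genuine subtraction occurs only in the last
-- transfer to ℤ.

private variable
  A B : Set

module PeakCounts where

  open import Data.Nat using (_+_; _*_; _^_; _/_; _<_; _<ᵇ_; _<?_; _≤′_; ≤′-refl; ≤′-step; _!)

  -- Finite sums over lists

  ∑ : List A → (A → ℕ) → ℕ
  ∑ []       f = 0
  ∑ (x ∷ xs) f = f x + ∑ xs f

  syntax ∑ xs (λ x → e) = ∑[ x ∈ xs ] e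
  infixr 8 ∑

  ∑-++ : (xs ys : List A) (f : A → ℕ) → ∑ (xs ++ ys) f ≡ ∑ xs f + ∑ ys f
  ∑-++ []       ys f = refl
  ∑-++ (x ∷ xs) ys f rewrite ∑-++ xs ys f = sym (ℕₚ.+-assoc (f x) _ _)

  ∑-map : (g : A → B) (xs : List A) (f : B → ℕ) → ∑ (map g xs) f ≡ ∑ xs (f ∘ g)
  ∑-map g []       f = refl
  ∑-map g (x ∷ xs) f = cong (f (g x) +_) (∑-map g xs f)

  ∑-concatMap : (g : A → List B) (xs : List A) (f : B → ℕ) → ∑ (concatMap g xs) f ≡ ∑[ x ∈ xs ] ∑ (g x) f
  ∑-concatMap g []       f = refl
  ∑-concatMap g (x ∷ xs) f = trans (∑-++ (g x) _ f) (cong (∑ (g x) f +_) (∑-concatMap g xs f))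

  ∑-cong-All : {f g : A → ℕ} {xs : List A} → All (λ x → f x ≡ g x) xs → ∑ xs f ≡ ∑ xs g
  ∑-cong-All []         = refl
  ∑-cong-All (eq ∷ eqs) = cong₂ _+_ eq (∑-cong-All eqs)

  ∑-cong : {f g : A → ℕ} (xs : List A) → (∀ x → f x ≡ g x) → ∑ xs f ≡ ∑ xs g
  ∑-cong xs eq = ∑-cong-All (All.universal eq xs)

  ∑-+ : (xs : List A) (f g : A → ℕ) → ∑[ x ∈ xs ] (f x + g x) ≡ ∑ xs f + ∑ xs g
  ∑-+ []       f g = refl
  ∑-+ (x ∷ xs) f g rewrite ∑-+ xs f g = interchange (f x) (g x) (∑ xs f) (∑ xs g)
    where
    interchange : ∀ a b c d → a + b + (c + d) ≡ a + c + (b + d)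
    interchange = ℕ-solve-∀

  ∑-*ˡ : (c : ℕ) (xs : List A) (f : A → ℕ) → ∑[ x ∈ xs ] (c * f x) ≡ c * ∑ xs f
  ∑-*ˡ c []       f = sym (ℕₚ.*-zeroʳ c)
  ∑-*ˡ c (x ∷ xs) f = trans (cong (c * f x +_) (∑-*ˡ c xs f)) (sym (ℕₚ.*-distribˡ-+ c (f x) _))

  ∑-*ʳ : (c : ℕ) (xs : List A) (f : A → ℕ) → ∑[ x ∈ xs ] (f x * c) ≡ ∑ xs f * c
  ∑-*ʳ c []       f = refl
  ∑-*ʳ c (x ∷ xs) f = trans (cong (f x * c +_) (∑-*ʳ c xs f)) (sym (ℕₚ.*-distribʳ-+ c (f x) _))

  ∑-const : (c : ℕ) (xs : List A) → ∑[ _ ∈ xs ] c ≡ length xs * c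
  ∑-const c []       = refl
  ∑-const c (x ∷ xs) = cong (c +_) (∑-const c xs)

  ∑-zero : (xs : List A) → ∑[ _ ∈ xs ] 0 ≡ 0
  ∑-zero xs = trans (∑-const 0 xs) (ℕₚ.*-zeroʳ (length xs))

  -- Indicators of equality of lists

  [_≐_] : List ℕ → List ℕ → ℕ
  [ xs ≐ ys ] = if does (≡-dec _≟_ xs ys) then 1 else 0

  ≐-yes : ∀ {xs ys} → xs ≡ ys → [ xs ≐ ys ] ≡ 1
  ≐-yes {xs} {ys} eq rewrite dec-true (≡-dec _≟_ xs ys) eq = refl

  ≐-no : ∀ {xs ys} → xs ≢ ys → [ xs ≐ ys ] ≡ 0
  ≐-no {xs} {ys} neq rewrite dec-false (≡-dec _≟_ xs ys) neq = refl

  ≐-cong : ∀ {xs ys xs′ ys′} → (xs ≡ ys → xs′ ≡ ys′) → (xs′ ≡ ys′ → xs ≡ ys) → [ xs ≐ ys ] ≡ [ xs′ ≐ ys′ ]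
  ≐-cong {xs} {ys} to from with ≡-dec _≟_ xs ys
  ... | yes eq  = sym (≐-yes (to eq))
  ... | no  neq = sym (≐-no (neq ∘ from))

  ≐-× : ∀ {xs ys xs₁ ys₁ xs₂ ys₂} → (xs ≡ ys → xs₁ ≡ ys₁ × xs₂ ≡ ys₂) → (xs₁ ≡ ys₁ → xs₂ ≡ ys₂ → xs ≡ ys) →
        [ xs ≐ ys ] ≡ [ xs₁ ≐ ys₁ ] * [ xs₂ ≐ ys₂ ]
  ≐-× {xs₁ = xs₁} {ys₁} to from with ≡-dec _≟_ xs₁ ys₁
  ... | yes eq = trans (≐-cong (proj₂ ∘ to) (from eq)) (sym (ℕₚ.+-identityʳ _))
  ... | no neq = ≐-no (neq ∘ proj₁ ∘ to)

  -- The threshold `k` marks the border inside the concatenation. This is how the peaks of a prefix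
  -- are recovered from the peak list of a whole word.
  ++-separated : ∀ k {xs xs′ ys ys′} → All (_< k) xs → All (_< k) xs′ → All (k ≤_) ys → All (k ≤_) ys′ →
                 xs ++ ys ≡ xs′ ++ ys′ → xs ≡ xs′ × ys ≡ ys′
  ++-separated k []       []       _         _         eq   = refl , eq
  ++-separated k []       (x ∷ _)  (y ∷ _)   _         refl = contradiction x (ℕₚ.≤⇒≯ y)
  ++-separated k (x ∷ _)  []       _         (y ∷ _)   refl = contradiction x (ℕₚ.≤⇒≯ y)
  ++-separated k (_ ∷ p)  (_ ∷ p′) q         q′        eq   with ∷-injective eq
  ... | refl , eq′ with ++-separated k p p′ q q′ eq′
  ... | refl , eq″ = refl , eq″

  -- Permutations and their prefixes

  -- Empty when k > length w, so that the summation formulas below need no side conditions.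
  cut : ℕ → List A → List (List A × List A)
  cut zero    w       = ([] , w) ∷ []
  cut (suc k) []      = []
  cut (suc k) (x ∷ w) = map (λ (u , v) → x ∷ u , v) (cut k w)

  cut-take-drop : ∀ k (w : List A) → k ≤ length w → cut k w ≡ (take k w , drop k w) ∷ []
  cut-take-drop zero    w       _         = refl
  cut-take-drop (suc k) (x ∷ w) (s≤s k≤w) rewrite cut-take-drop k w k≤w = refl

  -- Both components keep the order of the original list, so increasing lists split into increasing
  -- lists. The recursion is Pascal's rule.
  splits : ℕ → List A → List (List A × List A)
  splits zero    xs       = ([] , xs) ∷ []
  splits (suc k) []       = []
  splits (suc k) (x ∷ xs) = map (λ (u , v) → x ∷ u , v) (splits k xs) ++ map (λ (u , v) → u , x ∷ v) (splits (suc k) xs)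

  ∑-cut-∷ : ∀ (x : A) k w (F : List A → List A → ℕ) →
    ∑ (cut (suc k) (x ∷ w)) (λ (u , v) → F u v) ≡ ∑ (cut k w) (λ (u , v) → F (x ∷ u) v)
  ∑-cut-∷ x k w F = ∑-map _ (cut k w) _

  -- The new letter lies either among the first `suc k` letters, and deleting it leaves a cut after
  -- `k`, or in the remainder. Insertion at the end of `u` and at the front of `v` are different
  -- cases, so nothing is counted twice.
  ∑-insertions-cut : ∀ x k w (F : List ℕ → List ℕ → ℕ) →
    ∑[ w′ ∈ insertions x w ] ∑ (cut (suc k) w′) (λ (u , v) → F u v) ≡
      ∑ (cut k w) (λ (u , v) → ∑[ u′ ∈ insertions x u ] F u′ v) +
      ∑ (cut (suc k) w) (λ (u , v) → ∑[ v′ ∈ insertions x v ] F u v′)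
  ∑-insertions-cut x zero    []      F = sym (ℕₚ.+-identityʳ _)
  ∑-insertions-cut x (suc k) []      F = refl
  ∑-insertions-cut x zero    (y ∷ w) F = cong₂ _+_ (sym (ℕₚ.+-identityʳ _)) (begin
    ∑[ w′ ∈ map (y ∷_) (insertions x w) ] ∑ (cut 1 w′) (λ (u , v) → F u v) ≡⟨ ∑-map _ (insertions x w) _ ⟩
    ∑[ w′ ∈ insertions x w ] (F (y ∷ []) w′ + 0)  ≡⟨ ∑-cong (insertions x w) (λ _ → ℕₚ.+-identityʳ _) ⟩
    ∑[ w′ ∈ insertions x w ] F (y ∷ []) w′          ≡⟨ ℕₚ.+-identityʳ _ ⟨
    ∑[ w′ ∈ insertions x w ] F (y ∷ []) w′ + 0    ∎)
    where open ≡-Reasoning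
  ∑-insertions-cut x (suc k) (y ∷ w) F = begin
    ∑ (cut (2 + k) (x ∷ y ∷ w)) (λ (u , v) → F u v) +
      ∑[ w′ ∈ map (y ∷_) (insertions x w) ] ∑ (cut (2 + k) w′) (λ (u , v) → F u v)
      ≡⟨ cong₂ _+_ (trans (∑-cut-∷ x (suc k) (y ∷ w) F) (∑-cut-∷ y k w _)) (trans (∑-map _ (insertions x w) _) (∑-cong (insertions x w) (λ w′ → ∑-cut-∷ y (suc k) w′ F))) ⟩
    ∑ (cut k w) (λ (u , v) → F (x ∷ y ∷ u) v) +
      ∑[ w′ ∈ insertions x w ] ∑ (cut (suc k) w′) (λ (u , v) → F (y ∷ u) v)
      ≡⟨ cong (P +_) (∑-insertions-cut x k w (λ u → F (y ∷ u))) ⟩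
    P + (∑ (cut k w) (λ (u , v) → ∑[ u′ ∈ insertions x u ] F (y ∷ u′) v) + Q)
      ≡⟨ ℕₚ.+-assoc P _ Q ⟨
    P + ∑ (cut k w) (λ (u , v) → ∑[ u′ ∈ insertions x u ] F (y ∷ u′) v) + Q
      ≡⟨ cong (_+ Q) (∑-+ (cut k w) _ _) ⟨
    ∑ (cut k w) (λ (u , v) → F (x ∷ y ∷ u) v + ∑[ u′ ∈ insertions x u ] F (y ∷ u′) v) + Q
      ≡⟨ cong₂ _+_ (trans (∑-cut-∷ y k w _) (∑-cong (cut k w) (λ (u , v) → cong (F (x ∷ y ∷ u) v +_) (∑-map _ (insertions x u) _)))) (∑-cut-∷ y (suc k) w _) ⟨
    ∑ (cut (suc k) (y ∷ w)) (λ (u , v) → ∑[ u′ ∈ insertions x u ] F u′ v) +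
      ∑ (cut (2 + k) (y ∷ w)) (λ (u , v) → ∑[ v′ ∈ insertions x v ] F u v′) ∎
    where
    open ≡-Reasoning
    P = ∑ (cut k w) (λ (u , v) → F (x ∷ y ∷ u) v)
    Q = ∑ (cut (suc k) w) (λ (u , v) → ∑[ v′ ∈ insertions x v ] F (y ∷ u) v′)

  -- Choosing a permutation of xs amounts to choosing the set of its first k letters and ordering both parts.
  ∑-perms-cut : ∀ k xs (F : List ℕ → List ℕ → ℕ) →
    ∑[ w ∈ perms xs ] ∑ (cut k w) (λ (u , v) → F u v) ≡
      ∑ (splits k xs) (λ (as , bs) → ∑[ u ∈ perms as ] ∑[ v ∈ perms bs ] F u v)
  ∑-perms-cut zero    xs       F = begin
    ∑[ w ∈ perms xs ] (F [] w + 0)            ≡⟨ ∑-cong (perms xs) (λ _ → ℕₚ.+-identityʳ _) ⟩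
    ∑[ w ∈ perms xs ] F [] w                    ≡⟨ trans (ℕₚ.+-identityʳ _) (ℕₚ.+-identityʳ _) ⟨
    ∑[ w ∈ perms xs ] F [] w + 0 + 0        ∎
    where open ≡-Reasoning
  ∑-perms-cut (suc k) []       F = refl
  ∑-perms-cut (suc k) (x ∷ xs) F = begin
    ∑[ w ∈ perms (x ∷ xs) ] ∑ (cut (suc k) w) (λ (u , v) → F u v)
      ≡⟨ ∑-concatMap (insertions x) (perms xs) _ ⟩
    ∑[ w ∈ perms xs ] ∑[ w′ ∈ insertions x w ] ∑ (cut (suc k) w′) (λ (u , v) → F u v)
      ≡⟨ ∑-cong (perms xs) (λ w → ∑-insertions-cut x k w F) ⟩
    ∑[ w ∈ perms xs ] (∑ (cut k w) (λ (u , v) → ∑[ u′ ∈ insertions x u ] F u′ v) +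
                       ∑ (cut (suc k) w) (λ (u , v) → ∑[ v′ ∈ insertions x v ] F u v′))
      ≡⟨ ∑-+ (perms xs) _ _ ⟩
    ∑[ w ∈ perms xs ] ∑ (cut k w) (λ (u , v) → ∑[ u′ ∈ insertions x u ] F u′ v) +
    ∑[ w ∈ perms xs ] ∑ (cut (suc k) w) (λ (u , v) → ∑[ v′ ∈ insertions x v ] F u v′)
      ≡⟨ cong₂ _+_ (∑-perms-cut k xs _) (∑-perms-cut (suc k) xs _) ⟩
    ∑ (splits k xs) (λ (as , bs) → ∑[ u ∈ perms as ] ∑[ v ∈ perms bs ] ∑[ u′ ∈ insertions x u ] F u′ v) +
    ∑ (splits (suc k) xs) (λ (as , bs) → ∑[ u ∈ perms as ] ∑[ v ∈ perms bs ] ∑[ v′ ∈ insertions x v ] F u v′)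
      ≡⟨ cong₂ _+_
           (∑-cong (splits k xs) (λ (as , bs) → trans
             (∑-cong (perms as) (λ u → ∑-swap (perms bs) (insertions x u) _))
             (sym (∑-concatMap (insertions x) (perms as) _))))
           (∑-cong (splits (suc k) xs) (λ (as , bs) →
             ∑-cong (perms as) (λ u → sym (∑-concatMap (insertions x) (perms bs) _)))) ⟩
    ∑ (splits k xs) (λ (as , bs) → ∑[ u ∈ perms (x ∷ as) ] ∑[ v ∈ perms bs ] F u v) +
    ∑ (splits (suc k) xs) (λ (as , bs) → ∑[ u ∈ perms as ] ∑[ v ∈ perms (x ∷ bs) ] F u v)
      ≡⟨ cong₂ _+_ (∑-map _ (splits k xs) _) (∑-map _ (splits (suc k) xs) _) ⟨
    _ ≡⟨ ∑-++ (map _ (splits k xs)) (map _ (splits (suc k) xs)) _ ⟨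
    ∑ (splits (suc k) (x ∷ xs)) (λ (as , bs) → ∑[ u ∈ perms as ] ∑[ v ∈ perms bs ] F u v) ∎
    where
    open ≡-Reasoning
    ∑-swap : (xs : List A) (ys : List B) (f : A → B → ℕ) → ∑[ x ∈ xs ] ∑[ y ∈ ys ] f x y ≡ ∑[ y ∈ ys ] ∑[ x ∈ xs ] f x y
    ∑-swap []       ys f = sym (∑-zero ys)
    ∑-swap (x ∷ xs) ys f = trans (cong (∑ ys (f x) +_) (∑-swap xs ys f)) (sym (∑-+ ys _ _))

  length-splits : ∀ k (xs : List A) → length (splits k xs) ≡ length xs C k
  length-splits k xs = trans (sym (ℕₚ.*-identityʳ _)) (trans (sym (∑-const 1 (splits k xs))) (go k xs))
    where
    go : ∀ k (xs : List A) → ∑[ _ ∈ splits k xs ] 1 ≡ length xs C k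
    go zero    []       = refl
    go zero    (x ∷ xs) = go zero xs
    go (suc k) []       = refl
    go (suc k) (x ∷ xs) = begin
      ∑[ _ ∈ splits (suc k) (x ∷ xs) ] 1                         ≡⟨ ∑-++ (map _ (splits k xs)) _ _ ⟩
      _                                                          ≡⟨ cong₂ _+_ (∑-map _ (splits k xs) _) (∑-map _ (splits (suc k) xs) _) ⟩
      ∑[ _ ∈ splits k xs ] 1 + ∑[ _ ∈ splits (suc k) xs ] 1    ≡⟨ cong₂ _+_ (go k xs) (go (suc k) xs) ⟩
      length xs C k + length xs C suc k                        ≡⟨ nCk+nC[k+1]≡[n+1]C[k+1] (length xs) k ⟩
      suc (length xs) C suc k                                    ∎
      where open ≡-Reasoning

  splits-All : ∀ {P : A → Set} k {xs} → All P xs → All (λ (as , bs) → All P as × All P bs) (splits k xs)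
  splits-All zero    ps       = ([] , ps) ∷ []
  splits-All (suc k) []       = []
  splits-All (suc k) (p ∷ ps) = Allₚ.++⁺
    (Allₚ.map⁺ (All.map (λ (q , r) → p ∷ q , r) (splits-All k ps)))
    (Allₚ.map⁺ (All.map (λ (q , r) → q , p ∷ r) (splits-All (suc k) ps)))

  splits-AllPairs : ∀ {R : A → A → Set} k {xs} → AllPairs R xs →
    All (λ (as , bs) → AllPairs R as × AllPairs R bs) (splits k xs)
  splits-AllPairs zero    ps       = ([] , ps) ∷ []
  splits-AllPairs (suc k) []       = []
  splits-AllPairs (suc k) (p ∷ ps) = Allₚ.++⁺
    (Allₚ.map⁺ (All.zipWith (λ ((p , _) , (q , r)) → p ∷ q , r) (splits-All k p , splits-AllPairs k ps)))
    (Allₚ.map⁺ (All.zipWith (λ ((_ , p) , (q , r)) → q , p ∷ r) (splits-All (suc k) p , splits-AllPairs (suc k) ps)))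

  splits-length : ∀ k (xs : List A) → All (λ (as , bs) → length as ≡ k × k + length bs ≡ length xs) (splits k xs)
  splits-length zero    xs       = (refl , refl) ∷ []
  splits-length (suc k) []       = []
  splits-length (suc k) (x ∷ xs) = Allₚ.++⁺
    (Allₚ.map⁺ (All.map (λ (q , r) → cong suc q , cong suc r) (splits-length k xs)))
    (Allₚ.map⁺ (All.map (λ (q , r) → q , cong suc (trans (ℕₚ.+-suc k _) r)) (splits-length (suc k) xs)))

  insertions-↭ : ∀ x w → All (_↭ x ∷ w) (insertions x w)
  insertions-↭ x []      = ↭-refl ∷ []
  insertions-↭ x (y ∷ w) = ↭-refl ∷ Allₚ.map⁺ (All.map (λ p → ↭-trans (prep y p) (swap y x ↭-refl)) (insertions-↭ x w))

  perms-↭ : ∀ xs → All (_↭ xs) (perms xs)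
  perms-↭ []       = ↭-refl ∷ []
  perms-↭ (x ∷ xs) = Allₚ.concat⁺ (Allₚ.map⁺ (All.map (λ {w} w↭xs →
    All.map (λ p → ↭-trans p (prep x w↭xs)) (insertions-↭ x w)) (perms-↭ xs)))

  perms-length : ∀ xs → All (λ w → length w ≡ length xs) (perms xs)
  perms-length xs = All.map ↭-length (perms-↭ xs)

  -- Order-preserving relabelling

  insertions-map : ∀ (f : ℕ → ℕ) x w → insertions (f x) (map f w) ≡ map (map f) (insertions x w)
  insertions-map f x []      = refl
  insertions-map f x (y ∷ w) = cong ((f x ∷ f y ∷ map f w) ∷_) (begin
    map (f y ∷_) (insertions (f x) (map f w))    ≡⟨ cong (map (f y ∷_)) (insertions-map f x w) ⟩
    map (f y ∷_) (map (map f) (insertions x w))  ≡⟨ map-∘ (insertions x w) ⟨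
    map (λ v → f y ∷ map f v) (insertions x w)   ≡⟨ map-∘ (insertions x w) ⟩
    map (map f) (map (y ∷_) (insertions x w))    ∎)
    where open ≡-Reasoning

  perms-map : ∀ (f : ℕ → ℕ) xs → perms (map f xs) ≡ map (map f) (perms xs)
  perms-map f []       = refl
  perms-map f (x ∷ xs) = begin
    concatMap (insertions (f x)) (perms (map f xs))          ≡⟨ cong (concatMap (insertions (f x))) (perms-map f xs) ⟩
    concatMap (insertions (f x)) (map (map f) (perms xs))    ≡⟨ concatMap-map (insertions (f x)) (map f) (perms xs) ⟩
    concatMap (insertions (f x) ∘ map f) (perms xs)          ≡⟨ concatMap-cong (insertions-map f x) (perms xs) ⟩
    concatMap (map (map f) ∘ insertions x) (perms xs)        ≡⟨ map-concatMap (map f) (insertions x) (perms xs) ⟨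
    map (map f) (concatMap (insertions x) (perms xs))        ∎
    where open ≡-Reasoning

  <⇒<ᵇ≡true : ∀ {m n} → m < n → (m <ᵇ n) ≡ true
  <⇒<ᵇ≡true {m} {n} m<n = dec-true (m <? n) m<n

  ≮⇒<ᵇ≡false : ∀ {m n} → ¬ (m < n) → (m <ᵇ n) ≡ false
  ≮⇒<ᵇ≡false {m} {n} m≮n = dec-false (m <? n) m≮n

  StrictlyMonotone : (ℕ → ℕ) → Set
  StrictlyMonotone f = ∀ {i j} → i < j → f i < f j

  <ᵇ-mono : ∀ {f} → StrictlyMonotone f → ∀ i j → (f i <ᵇ f j) ≡ (i <ᵇ j)
  <ᵇ-mono {f} mono i j with ℕₚ.<-cmp i j
  ... | tri< i<j _ _   = trans (<⇒<ᵇ≡true (mono i<j)) (sym (<⇒<ᵇ≡true i<j))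
  ... | tri≈ i≮j refl _ = trans (≮⇒<ᵇ≡false {f i} (ℕₚ.<-irrefl refl)) (sym (≮⇒<ᵇ≡false i≮j))
  ... | tri> i≮j _ j<i = trans (≮⇒<ᵇ≡false (ℕₚ.<-asym (mono j<i))) (sym (≮⇒<ᵇ≡false i≮j))

  peaksFrom-map : ∀ {f} → StrictlyMonotone f → ∀ k w → peaksFrom k (map f w) ≡ peaksFrom k w
  peaksFrom-map mono k []               = refl
  peaksFrom-map mono k (a ∷ [])         = refl
  peaksFrom-map mono k (a ∷ b ∷ [])     = refl
  peaksFrom-map mono k (a ∷ b ∷ c ∷ w)
    rewrite peaksFrom-map mono (suc k) (b ∷ c ∷ w) | <ᵇ-mono mono a b | <ᵇ-mono mono c b = refl

  -- The list is extended by consecutive numbers, which keeps the enumeration strictly monotone on all of ℕ.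
  enumerate : ℕ → List ℕ → ℕ → ℕ
  enumerate x []       i       = x + i
  enumerate x (y ∷ ys) zero    = x
  enumerate x (y ∷ ys) (suc i) = enumerate y ys i

  enumerate-applyUpTo : ∀ x xs → applyUpTo (enumerate x xs) (suc (length xs)) ≡ x ∷ xs
  enumerate-applyUpTo x []       = cong (_∷ []) (ℕₚ.+-identityʳ x)
  enumerate-applyUpTo x (y ∷ ys) = cong (x ∷_) (enumerate-applyUpTo y ys)

  enumerate-zero : ∀ x xs → enumerate x xs 0 ≡ x
  enumerate-zero x []      = ℕₚ.+-identityʳ x
  enumerate-zero x (_ ∷ _) = refl

  enumerate-step : ∀ {x xs} → AllPairs _<_ (x ∷ xs) → ∀ i → enumerate x xs i < enumerate x xs (suc i)
  enumerate-step {x} {[]}     _                i       = ℕₚ.+-monoʳ-< x (ℕₚ.n<1+n i)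
  enumerate-step {x} {y ∷ ys} ((x<y ∷ _) ∷ _)  zero    = subst (x <_) (sym (enumerate-zero y ys)) x<y
  enumerate-step {x} {y ∷ ys} (_ ∷ increasing) (suc i) = enumerate-step increasing i

  step⇒monotone : ∀ {f} → (∀ i → f i < f (suc i)) → StrictlyMonotone f
  step⇒monotone {f} step {i} i<j = go (ℕₚ.≤⇒≤′ i<j)
    where
    go : ∀ {j} → suc i ≤′ j → f i < f j
    go ≤′-refl       = step i
    go (≤′-step i<j) = ℕₚ.<-trans (go i<j) (step _)

  count : List ℕ → ℕ → ℕ
  count S n = ∑[ w ∈ perms (upTo n) ] [ peaks w ≐ S ]

  -- A strictly monotone map carries `upTo n` onto the given list, `perms` commutes with it, and
  -- peaks depend only on comparisons. Hence `{1,…,n}`, `{0,…,n−1}` and the letter sets of both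
  -- parts of a cut word can be treated alike.
  count-increasing : ∀ S {n xs} → AllPairs _<_ xs → length xs ≡ n → ∑[ w ∈ perms xs ] [ peaks w ≐ S ] ≡ count S n
  count-increasing S {xs = []}     _          refl = refl
  count-increasing S {xs = x ∷ xs} increasing refl = begin
    ∑[ w ∈ perms (x ∷ xs) ] [ peaks w ≐ S ]
      ≡⟨ cong (λ ys → ∑[ w ∈ perms ys ] [ peaks w ≐ S ]) (trans (map-applyUpTo id f n) (enumerate-applyUpTo x xs)) ⟨
    ∑[ w ∈ perms (map f (upTo n)) ] [ peaks w ≐ S ]
      ≡⟨ cong (λ ws → ∑[ w ∈ ws ] [ peaks w ≐ S ]) (perms-map f (upTo n)) ⟩
    ∑[ w ∈ map (map f) (perms (upTo n)) ] [ peaks w ≐ S ]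
      ≡⟨ ∑-map (map f) (perms (upTo n)) _ ⟩
    ∑[ w ∈ perms (upTo n) ] [ peaks (map f w) ≐ S ]
      ≡⟨ ∑-cong (perms (upTo n)) (λ w → cong [_≐ S ] (peaksFrom-map (step⇒monotone (enumerate-step increasing)) 2 w)) ⟩
    count S n ∎
    where
    open ≡-Reasoning
    f = enumerate x xs
    n = suc (length xs)

  upTo-increasing : ∀ n → AllPairs _<_ (upTo n)
  upTo-increasing n = AllPairsₚ.applyUpTo⁺₁ id n (λ i<j _ → i<j)

  #P≡count : ∀ S n → #P S n ≡ count S n
  #P≡count S n = begin
    #P S n                                  ≡⟨ length-filter-∑ (Perm n) ⟩
    ∑[ w ∈ perms (oneTo n) ] [ peaks w ≐ S ] ≡⟨ count-increasing S
      (AllPairsₚ.map⁺ (AllPairs.map s≤s (upTo-increasing n))) (trans (length-map suc (upTo n)) (length-upTo n)) ⟩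
    count S n                               ∎
    where
    open ≡-Reasoning
    length-filter-∑ : ∀ ws → length (filter (λ w → ≡-dec _≟_ (peaks w) S) ws) ≡ ∑[ w ∈ ws ] [ peaks w ≐ S ]
    length-filter-∑ []       = refl
    length-filter-∑ (w ∷ ws) with does (≡-dec _≟_ (peaks w) S)
    ... | true  = cong suc (length-filter-∑ ws)
    ... | false = length-filter-∑ ws

  -- Peak sets

  <ᵇ-asym : ∀ a b → (a <ᵇ b) ≡ true → (b <ᵇ a) ≡ false
  <ᵇ-asym a b a<b = ≮⇒<ᵇ≡false (ℕₚ.<-asym (ℕₚ.<ᵇ⇒< a b (subst T (sym a<b) tt)))

  peaksFrom-shift : ∀ k j w → peaksFrom (k + j) w ≡ map (k +_) (peaksFrom j w)
  peaksFrom-shift k j []           = refl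
  peaksFrom-shift k j (a ∷ [])     = refl
  peaksFrom-shift k j (a ∷ b ∷ []) = refl
  peaksFrom-shift k j (a ∷ b ∷ c ∷ w) with (a <ᵇ b) ∧ (c <ᵇ b) | peaksFrom-shift k (suc j) (b ∷ c ∷ w)
  ... | true  | eq rewrite ℕₚ.+-suc k j = cong (_ ∷_) eq
  ... | false | eq rewrite ℕₚ.+-suc k j = eq

  peaksFrom-≥ : ∀ k w → All (k ≤_) (peaksFrom k w)
  peaksFrom-≥ k []           = []
  peaksFrom-≥ k (a ∷ [])     = []
  peaksFrom-≥ k (a ∷ b ∷ []) = []
  peaksFrom-≥ k (a ∷ b ∷ c ∷ w) with (a <ᵇ b) ∧ (c <ᵇ b) | All.map ℕₚ.<⇒≤ (peaksFrom-≥ (suc k) (b ∷ c ∷ w))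
  ... | true  | ih = ℕₚ.≤-refl ∷ ih
  ... | false | ih = ih

  -- With window index `2 + k` the word occupies the positions `k + 1` to `k + length w`, and its
  -- last letter has no right neighbour.
  peaksFrom-< : ∀ k w → All (_< k + length w) (peaksFrom (2 + k) w)
  peaksFrom-< k []           = []
  peaksFrom-< k (a ∷ [])     = []
  peaksFrom-< k (a ∷ b ∷ []) = []
  peaksFrom-< k (a ∷ b ∷ c ∷ w) with (a <ᵇ b) ∧ (c <ᵇ b) | peaksFrom-< (suc k) (b ∷ c ∷ w)
  ... | true  | ih rewrite ℕₚ.+-suc k (2 + length w) = s≤s (subst (_≤ k + (2 + length w)) (ℕₚ.+-comm k 2) (ℕₚ.+-monoʳ-≤ k (s≤s (s≤s z≤n)))) ∷ ih
  ... | false | ih rewrite ℕₚ.+-suc k (2 + length w) = ih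

  peaksFrom-gaps : ∀ k w → Linked (λ i j → 2 + i ≤ j) (peaksFrom k w)
  peaksFrom-gaps k []           = []
  peaksFrom-gaps k (a ∷ [])     = []
  peaksFrom-gaps k (a ∷ b ∷ []) = []
  peaksFrom-gaps k (a ∷ b ∷ c ∷ w) with a <ᵇ b | c <ᵇ b in c<b | peaksFrom-gaps (suc k) (b ∷ c ∷ w)
  ... | false | _     | ih = ih
  ... | true  | false | ih = ih
  peaksFrom-gaps k (a ∷ b ∷ c ∷ [])    | true | true | ih = [-]
  peaksFrom-gaps k (a ∷ b ∷ c ∷ d ∷ w) | true | true | ih
    -- A peak at `b` makes the test `b <ᵇ c` fail, so the next window contributes nothing and the
    -- remaining peaks start at `2 + k` or later.
    rewrite <ᵇ-asym c b c<b = cons (peaksFrom-≥ (2 + k) (c ∷ d ∷ w)) ih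
    where
    cons : ∀ {i js} → All (2 + i ≤_) js → Linked (λ i j → 2 + i ≤ j) js → Linked (λ i j → 2 + i ≤ j) (i ∷ js)
    cons []      _  = [-]
    cons (r ∷ _) rs = r ∷ rs

  data Junction (k : ℕ) : List ℕ → Set where
    none  : Junction k []
    left  : Junction k (k ∷ [])
    right : Junction k (suc k ∷ [])

  -- Only the last letter of u and the first letter of v can become peaks, and not both since they are neighbours.
  peaksFrom-++ : ∀ k u v → ∃ λ js → Junction (k + length u) js ×
    peaksFrom (2 + k) (u ++ v) ≡ peaksFrom (2 + k) u ++ js ++ peaksFrom (2 + (k + length u)) v
  peaksFrom-++ k [] v rewrite ℕₚ.+-identityʳ k = [] , none , refl
  peaksFrom-++ k (a ∷ []) []          = [] , none , refl
  peaksFrom-++ k (a ∷ []) (b ∷ [])    = [] , none , refl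
  peaksFrom-++ k (a ∷ []) (b ∷ c ∷ v) rewrite ℕₚ.+-comm k 1 with (a <ᵇ b) ∧ (c <ᵇ b)
  ... | true  = _ , right , refl
  ... | false = _ , none , refl
  peaksFrom-++ k (a ∷ b ∷ []) []       = [] , none , refl
  peaksFrom-++ k (a ∷ b ∷ []) (c ∷ []) rewrite ℕₚ.+-comm k 2 with (a <ᵇ b) ∧ (c <ᵇ b)
  ... | true  = _ , left , refl
  ... | false = _ , none , refl
  peaksFrom-++ k (a ∷ b ∷ []) (c ∷ d ∷ v) rewrite ℕₚ.+-comm k 2 with a <ᵇ b | c <ᵇ b in c<b
  ... | true  | true rewrite <ᵇ-asym c b c<b = _ , left , refl
  ... | true  | false with (b <ᵇ c) ∧ (d <ᵇ c)
  ...   | true  = _ , right , refl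
  ...   | false = _ , none , refl
  peaksFrom-++ k (a ∷ b ∷ []) (c ∷ d ∷ v) | false | _ with (b <ᵇ c) ∧ (d <ᵇ c)
  ...   | true  = _ , right , refl
  ...   | false = _ , none , refl
  peaksFrom-++ k (a ∷ b ∷ c ∷ u) v with peaksFrom-++ (suc k) (b ∷ c ∷ u) v
  ... | js , junction , eq rewrite ℕₚ.+-suc k (2 + length u) with (a <ᵇ b) ∧ (c <ᵇ b)
  ...   | true  = js , junction , cong (_ ∷_) eq
  ...   | false = js , junction , eq

  -- Peaks below `k` belong to `u`; the junction and the peaks of `v` lie at `k` or above. The
  -- indicator of the prefix therefore factors out of each summand. Since the peaks of `v` and the
  -- entries of `S₂′` are at least `2 + k`, only the summand that fits the actual junction can be
  -- nonzero.
  peaks-junction : ∀ {k S₁ S₂} u v → length u ≡ k → All (_< k) S₁ → All (2 ≤_) S₂ →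
    let S₂′ = map (k +_) S₂ in
    [ peaks u ≐ S₁ ] * [ peaks v ≐ S₂ ] ≡
      [ peaks (u ++ v) ≐ S₁ ++ S₂′ ] + [ peaks (u ++ v) ≐ S₁ ++ k ∷ S₂′ ] + [ peaks (u ++ v) ≐ S₁ ++ suc k ∷ S₂′ ]
  peaks-junction {S₁ = S₁} {S₂} u v refl S₁< ≤S₂ with peaksFrom-++ 0 u v
  ... | js , junction , eq = sym (begin
    [ peaks (u ++ v) ≐ S₁ ++ S₂′ ] + [ peaks (u ++ v) ≐ S₁ ++ k ∷ S₂′ ] + [ peaks (u ++ v) ≐ S₁ ++ suc k ∷ S₂′ ]
      ≡⟨ cong₂ _+_ (cong₂ _+_ (factor (lower ≤S₂′)) (factor (ℕₚ.≤-refl ∷ lower ≤S₂′)))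
                     (factor (ℕₚ.n≤1+n k ∷ lower ≤S₂′)) ⟩
    α * [ js ++ q ≐ S₂′ ] + α * [ js ++ q ≐ k ∷ S₂′ ] + α * [ js ++ q ≐ suc k ∷ S₂′ ]
      ≡⟨ distrib α _ _ _ ⟩
    α * ([ js ++ q ≐ S₂′ ] + [ js ++ q ≐ k ∷ S₂′ ] + [ js ++ q ≐ suc k ∷ S₂′ ])
      ≡⟨ cong (α *_) (three junction) ⟩
    α * [ q ≐ S₂′ ]
      ≡⟨ cong (α *_) shift ⟩
    α * [ peaks v ≐ S₂ ] ∎)
    where
    open ≡-Reasoning
    k   = length u
    S₂′ = map (k +_) S₂
    q   = peaksFrom (2 + k) v
    α   = [ peaks u ≐ S₁ ]

    distrib : ∀ a x y z → a * x + a * y + a * z ≡ a * (x + y + z)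
    distrib = ℕ-solve-∀

    ≤S₂′ : All (2 + k ≤_) S₂′
    ≤S₂′ = Allₚ.map⁺ (All.map (λ {i} 2≤i → subst (_≤ k + i) (ℕₚ.+-comm k 2) (ℕₚ.+-monoʳ-≤ k 2≤i)) ≤S₂)

    ≤q : All (2 + k ≤_) q
    ≤q = peaksFrom-≥ (2 + k) v

    lower : ∀ {T} → All (2 + k ≤_) T → All (k ≤_) T
    lower = All.map (ℕₚ.≤-trans (ℕₚ.m≤n+m k 2))

    ≤js : ∀ {js} → Junction k js → All (k ≤_) js
    ≤js none  = []
    ≤js left  = ℕₚ.≤-refl ∷ []
    ≤js right = ℕₚ.n≤1+n k ∷ []

    factor : ∀ {T} → All (k ≤_) T → [ peaks (u ++ v) ≐ S₁ ++ T ] ≡ α * [ js ++ q ≐ T ]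
    factor ≤T = ≐-×
      (λ e → ++-separated k (peaksFrom-< 0 u) S₁< (Allₚ.++⁺ (≤js junction) (lower ≤q)) ≤T (trans (sym eq) e))
      (λ e e′ → trans eq (cong₂ _++_ e e′))

    head≢ : ∀ {i T R} → i < 2 + k → All (2 + k ≤_) T → T ≢ i ∷ R
    head≢ i< (≤i ∷ _) refl = contradiction i< (ℕₚ.≤⇒≯ ≤i)

    k< : k < 2 + k
    k< = ℕₚ.m<n+m k (s≤s z≤n)

    three : ∀ {js} → Junction k js →
      [ js ++ q ≐ S₂′ ] + [ js ++ q ≐ k ∷ S₂′ ] + [ js ++ q ≐ suc k ∷ S₂′ ] ≡ [ q ≐ S₂′ ]
    three none
      rewrite ≐-no (head≢ {R = S₂′} k< ≤q) | ≐-no (head≢ {R = S₂′} (ℕₚ.n<1+n (suc k)) ≤q)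
      = trans (ℕₚ.+-identityʳ _) (ℕₚ.+-identityʳ _)
    three left
      rewrite ≐-no (head≢ {R = q} k< ≤S₂′ ∘ sym) | ≐-no {k ∷ q} {suc k ∷ S₂′} (λ e → ℕₚ.1+n≢n (sym (∷-injectiveˡ e)))
      = trans (ℕₚ.+-identityʳ _) (≐-cong {k ∷ q} {k ∷ S₂′} ∷-injectiveʳ (cong (k ∷_)))
    three right
      rewrite ≐-no (head≢ {R = q} (ℕₚ.n<1+n (suc k)) ≤S₂′ ∘ sym) | ≐-no {suc k ∷ q} {k ∷ S₂′} (λ e → ℕₚ.1+n≢n (∷-injectiveˡ e))
      = ≐-cong {suc k ∷ q} {suc k ∷ S₂′} ∷-injectiveʳ (cong (suc k ∷_))

    q≡ : q ≡ map (k +_) (peaks v)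
    q≡ = trans (cong (λ j → peaksFrom j v) (ℕₚ.+-comm 2 k)) (peaksFrom-shift k 2 v)

    shift : [ q ≐ S₂′ ] ≡ [ peaks v ≐ S₂ ]
    shift = ≐-cong (λ e → map-injective (ℕₚ.+-cancelˡ-≡ k _ _) (trans (sym q≡) e))
                   (λ e → trans q≡ (cong (map (k +_)) e))

  -- `n` and `S₂′` are tied to the parts by equations, so that each use can present them in the
  -- arithmetic form it needs.
  count-split : ∀ k l {n S₁ S₂ S₂′} → k + l ≡ n → map (k +_) S₂ ≡ S₂′ → All (_< k) S₁ → All (2 ≤_) S₂ →
    (n C k) * (count S₁ k * count S₂ l) ≡ count (S₁ ++ S₂′) n + count (S₁ ++ k ∷ S₂′) n + count (S₁ ++ suc k ∷ S₂′) n
  count-split k l {S₁ = S₁} {S₂} refl refl S₁< ≤S₂ = begin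
    (n C k) * (count S₁ k * count S₂ l)
      ≡⟨ cong (_* (count S₁ k * count S₂ l)) (trans (length-splits k xs) (cong (_C k) (length-upTo n))) ⟨
    length (splits k xs) * (count S₁ k * count S₂ l)
      ≡⟨ ∑-const _ (splits k xs) ⟨
    ∑[ _ ∈ splits k xs ] (count S₁ k * count S₂ l)
      ≡⟨ ∑-cong-All (All.zipWith product (splits-AllPairs k (upTo-increasing n) , splits-length k xs)) ⟨
    ∑ (splits k xs) (λ (as , bs) → ∑[ u ∈ perms as ] ∑[ v ∈ perms bs ] ([ peaks u ≐ S₁ ] * [ peaks v ≐ S₂ ]))
      ≡⟨ ∑-perms-cut k xs _ ⟨
    ∑[ w ∈ perms xs ] ∑ (cut k w) (λ (u , v) → [ peaks u ≐ S₁ ] * [ peaks v ≐ S₂ ])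
      ≡⟨ ∑-cong-All (All.map (λ {w} → junction w) (perms-length xs)) ⟩
    ∑[ w ∈ perms xs ] ([ peaks w ≐ S₁ ++ S₂′ ] + [ peaks w ≐ S₁ ++ k ∷ S₂′ ] + [ peaks w ≐ S₁ ++ suc k ∷ S₂′ ])
      ≡⟨ trans (∑-+ (perms xs) _ _) (cong (_+ count (S₁ ++ suc k ∷ S₂′) n) (∑-+ (perms xs) _ _)) ⟩
    count (S₁ ++ S₂′) n + count (S₁ ++ k ∷ S₂′) n + count (S₁ ++ suc k ∷ S₂′) n ∎
    where
    open ≡-Reasoning
    n   = k + l
    xs  = upTo n
    S₂′ = map (k +_) S₂

    product : ∀ {(as , bs) : List ℕ × List ℕ} →
      (AllPairs _<_ as × AllPairs _<_ bs) × (length as ≡ k × k + length bs ≡ length xs) →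
      ∑[ u ∈ perms as ] ∑[ v ∈ perms bs ] ([ peaks u ≐ S₁ ] * [ peaks v ≐ S₂ ]) ≡ count S₁ k * count S₂ l
    product {as , bs} ((as< , bs<) , (|as| , |as|+|bs|)) = begin
      ∑[ u ∈ perms as ] ∑[ v ∈ perms bs ] ([ peaks u ≐ S₁ ] * [ peaks v ≐ S₂ ])
        ≡⟨ ∑-cong (perms as) (λ u → ∑-*ˡ [ peaks u ≐ S₁ ] (perms bs) _) ⟩
      ∑[ u ∈ perms as ] ([ peaks u ≐ S₁ ] * ∑[ v ∈ perms bs ] [ peaks v ≐ S₂ ])
        ≡⟨ ∑-*ʳ _ (perms as) _ ⟩
      ∑[ u ∈ perms as ] [ peaks u ≐ S₁ ] * ∑[ v ∈ perms bs ] [ peaks v ≐ S₂ ]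
        ≡⟨ cong₂ _*_ (count-increasing S₁ as< |as|)
             (count-increasing S₂ bs< (ℕₚ.+-cancelˡ-≡ k _ _ (trans |as|+|bs| (length-upTo n)))) ⟩
      count S₁ k * count S₂ l ∎

    k≤length : ∀ w → length w ≡ length xs → k ≤ length w
    k≤length w |w| = subst (k ≤_) (sym (trans |w| (length-upTo n))) (ℕₚ.m≤m+n k l)

    junction : ∀ w → length w ≡ length xs →
      ∑ (cut k w) (λ (u , v) → [ peaks u ≐ S₁ ] * [ peaks v ≐ S₂ ]) ≡
      [ peaks w ≐ S₁ ++ S₂′ ] + [ peaks w ≐ S₁ ++ k ∷ S₂′ ] + [ peaks w ≐ S₁ ++ suc k ∷ S₂′ ]
    junction w |w| rewrite cut-take-drop k w (k≤length w |w|) = begin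
      [ peaks u ≐ S₁ ] * [ peaks v ≐ S₂ ] + 0  ≡⟨ ℕₚ.+-identityʳ _ ⟩
      [ peaks u ≐ S₁ ] * [ peaks v ≐ S₂ ]        ≡⟨ peaks-junction u v (trans (length-take k w) (ℕₚ.m≤n⇒m⊓n≡m (k≤length w |w|))) S₁< ≤S₂ ⟩
      _ ≡⟨ cong (λ w → [ peaks w ≐ S₁ ++ S₂′ ] + [ peaks w ≐ S₁ ++ k ∷ S₂′ ] + [ peaks w ≐ S₁ ++ suc k ∷ S₂′ ]) (take++drop≡id k w) ⟩
      [ peaks w ≐ S₁ ++ S₂′ ] + [ peaks w ≐ S₁ ++ k ∷ S₂′ ] + [ peaks w ≐ S₁ ++ suc k ∷ S₂′ ] ∎
      where
      u = take k w
      v = drop k w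

  count-zero : ∀ S n → (∀ w → length w ≡ n → peaks w ≢ S) → count S n ≡ 0
  count-zero S n peaks≢S = trans
    (∑-cong-All (All.map (λ {w} |w| → ≐-no (peaks≢S w (trans |w| (length-upTo n)))) (perms-length (upTo n))))
    (∑-zero (perms (upTo n)))

  count-low : ∀ {i} S n → i < 2 → count (i ∷ S) n ≡ 0
  count-low S n i<2 = count-zero (_ ∷ S) n λ w _ eq → case subst (All (2 ≤_)) eq (peaksFrom-≥ 2 w) of λ where
    (2≤i ∷ _) → contradiction i<2 (ℕₚ.≤⇒≯ 2≤i)

  count-high : ∀ S {i} n → n ≤ i → count (S ++ i ∷ []) n ≡ 0
  count-high S {i} n n≤i = count-zero (S ++ i ∷ []) n λ w |w| eq →
    case Allₚ.++⁻ʳ S (subst (All (_< length w)) eq (peaksFrom-< 0 w)) of λ where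
      (i<|w| ∷ _) → contradiction (subst (_ <_) |w| i<|w|) (ℕₚ.≤⇒≯ n≤i)

  count-adjacent : ∀ S {i} S′ n → count (S ++ i ∷ suc i ∷ S′) n ≡ 0
  count-adjacent S {i} S′ n = count-zero (S ++ i ∷ suc i ∷ S′) n λ w _ eq → ¬adjacent S (subst (Linked _) eq (peaksFrom-gaps 2 w))
    where
    ¬adjacent : ∀ S {i S′} → ¬ Linked (λ i j → 2 + i ≤ j) (S ++ i ∷ suc i ∷ S′)
    ¬adjacent []          (2+i≤1+i ∷ _) = ℕₚ.1+n≰n 2+i≤1+i
    ¬adjacent (_ ∷ [])    (_ ∷ rs)      = ¬adjacent [] rs
    ¬adjacent (_ ∷ _ ∷ S) (_ ∷ rs)      = ¬adjacent (_ ∷ S) rs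

  -- Permutations without peaks

  increasing : List ℕ → ℕ
  increasing (y ∷ z ∷ w) = if y <ᵇ z then increasing (z ∷ w) else 0
  increasing _           = 1

  valley : List ℕ → ℕ
  valley (y ∷ z ∷ w) = if y <ᵇ z then increasing (z ∷ w) else valley (z ∷ w)
  valley _           = 1

  -- For distinct letters a step that is not an ascent is a descent, and an ascent followed by a
  -- descent is a peak. A word without peaks thus only ascends after its first ascent: it decreases
  -- and then increases.
  valley-peaks : ∀ k {w} → AllPairs _≢_ w → [ peaksFrom k w ≐ [] ] ≡ valley w
  valley-peaks k {[]}         _ = refl
  valley-peaks k {y ∷ []}     _ = refl
  valley-peaks k {y ∷ z ∷ []} _ with y <ᵇ z
  ... | true  = refl
  ... | false = refl
  valley-peaks k {y ∷ z ∷ t ∷ w} (_ ∷ distinct@((z≢t ∷ _) ∷ _)) with y <ᵇ z | valley-peaks (suc k) distinct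
  ... | false | ih = ih
  ... | true  | ih with ℕₚ.<-cmp z t
  ...   | tri< z<t _ t≮z rewrite <⇒<ᵇ≡true z<t | ≮⇒<ᵇ≡false t≮z = ih
  ...   | tri≈ _ z≡t _ = contradiction z≡t z≢t
  ...   | tri> z≮t _ t<z rewrite <⇒<ᵇ≡true t<z | ≮⇒<ᵇ≡false z≮t = refl

  -- Wherever `x` is placed behind `y`, it is smaller than its left neighbour and produces a
  -- descent.
  ∑-insertions-increasing : ∀ {x y} w → x < y → All (x <_) w → ∑[ v ∈ insertions x w ] increasing (y ∷ v) ≡ 0
  ∑-insertions-increasing []      x<y _ rewrite ≮⇒<ᵇ≡false (ℕₚ.<-asym x<y) = refl
  ∑-insertions-increasing {x} {y} (z ∷ w) x<y (x<z ∷ x<w)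
    rewrite ≮⇒<ᵇ≡false (ℕₚ.<-asym x<y) | ∑-map (z ∷_) (insertions x w) (λ v → increasing (y ∷ v)) with y <ᵇ z
  ... | true  = ∑-insertions-increasing w x<z x<w
  ... | false = ∑-zero (insertions x w)

  -- A new minimum avoids creating a peak exactly when it is put next to the old one, on either side;
  -- the first summand accounts for the position in front of y.
  ∑-insertions-valley : ∀ {x y} w → x < y → All (x <_) w →
    increasing (y ∷ w) + ∑[ v ∈ insertions x w ] valley (y ∷ v) ≡ 2 * valley (y ∷ w)
  ∑-insertions-valley []      x<y _ rewrite ≮⇒<ᵇ≡false (ℕₚ.<-asym x<y) = refl
  ∑-insertions-valley {x} {y} (z ∷ w) x<y (x<z ∷ x<w)
    rewrite ≮⇒<ᵇ≡false (ℕₚ.<-asym x<y) | <⇒<ᵇ≡true x<z | ∑-map (z ∷_) (insertions x w) (λ v → valley (y ∷ v)) with y <ᵇ z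
  ... | true  rewrite ∑-insertions-increasing w x<z x<w = refl
  ... | false = ∑-insertions-valley w x<z x<w

  ∑-perms-valley : ∀ {n xs} → AllPairs _<_ xs → length xs ≡ suc n → ∑ (perms xs) valley ≡ 2 ^ n
  ∑-perms-valley {zero}  {x ∷ []}     _            refl = refl
  ∑-perms-valley {suc n} {x ∷ xs}     (x<xs ∷ xs<) |xs| = begin
    ∑ (perms (x ∷ xs)) valley                            ≡⟨ ∑-concatMap (insertions x) (perms xs) valley ⟩
    ∑[ w ∈ perms xs ] ∑[ v ∈ insertions x w ] valley v   ≡⟨ ∑-cong-All (All.map (λ {w} → double w) (perms-↭ xs)) ⟩
    ∑[ w ∈ perms xs ] (2 * valley w)                   ≡⟨ ∑-*ˡ 2 (perms xs) valley ⟩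
    2 * ∑ (perms xs) valley                            ≡⟨ cong (2 *_) (∑-perms-valley xs< (ℕₚ.suc-injective |xs|)) ⟩
    2 * 2 ^ n                                          ∎
    where
    open ≡-Reasoning
    double : ∀ w → w ↭ xs → ∑[ v ∈ insertions x w ] valley v ≡ 2 * valley w
    double []      w↭xs = contradiction (trans (↭-length w↭xs) (ℕₚ.suc-injective |xs|)) λ ()
    double (y ∷ w) w↭xs with All-resp-↭ (↭-sym w↭xs) x<xs
    ... | x<y ∷ x<w rewrite <⇒<ᵇ≡true x<y | ∑-map (y ∷_) (insertions x w) valley = ∑-insertions-valley w x<y x<w

  count-∅ : ∀ n → count [] (suc n) ≡ 2 ^ n
  count-∅ n = trans
    (∑-cong-All (All.map (λ w↭ → valley-peaks 2 (AllPairs-resp-↭ ≢-sym ≢-resp (↭⇒↭ₛ (↭-sym w↭)) distinct)) (perms-↭ (upTo (suc n)))))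
    (∑-perms-valley (upTo-increasing (suc n)) (length-upTo (suc n)))
    where
    distinct : AllPairs _≢_ (upTo (suc n))
    distinct = AllPairs.map ℕₚ.<⇒≢ (upTo-increasing (suc n))
    ≢-resp : _≢_ {A = ℕ} Respects₂ _≡_
    ≢-resp = subst (_ ≢_) , subst (_≢ _)

  -- Binomial coefficients

  choose-! : ∀ k l {n} → k + l ≡ n → (n C k) * (k ! * l !) ≡ n !
  choose-! k l refl = begin
    (n C k) * (k ! * l !)                               ≡⟨ cong (λ j → (n C k) * (k ! * j !)) (ℕₚ.m+n∸m≡n k l) ⟨
    (n C k) * (k ! * (n ∸ k) !)                       ≡⟨ cong (_* (k ! * (n ∸ k) !)) (nCk≡n!/k![n-k]! k≤n) ⟩
    n ! / (k ! * (n ∸ k) !) * (k ! * (n ∸ k) !) ≡⟨ m/n*n≡m (k![n∸k]!∣n! k≤n) ⟩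
    n !                                                     ∎
    where
    open ≡-Reasoning
    n = k + l
    k≤n : k ≤ n
    k≤n = ℕₚ.m≤m+n k l
    instance
      _ = k !* (n ∸ k) !≢0

  [1+n]Cn≡1+n : ∀ n → suc n C n ≡ suc n
  [1+n]Cn≡1+n n = begin
    suc n C n              ≡⟨ nCk≡nC[n∸k] (ℕₚ.n≤1+n n) ⟩
    suc n C (suc n ∸ n)  ≡⟨ cong (suc n C_) (ℕₚ.m+n∸n≡m 1 n) ⟩
    suc n C 1              ≡⟨ nC1≡n (suc n) ⟩
    suc n                  ∎
    where open ≡-Reasoning

  +-interchange : ∀ i j a b → i + a + (j + b) ≡ i + j + (a + b)
  +-interchange = ℕ-solve-∀

  -- Multiplied by `k ! * l !`, both sides become `(2 + n) !`.
  choose-absorb : ∀ k l {n} → k + l ≡ n →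
    suc k * suc l * ((2 + n) C suc k) ≡ (2 + n) * (1 + n) * (n C k)
  choose-absorb k l {n} k+l≡n = ℕₚ.*-cancelʳ-≡ _ _ (k ! * l !) (begin
    suc k * suc l * c * (k ! * l !)                 ≡⟨ rearrange (suc k) (suc l) c (k !) (l !) ⟩
    c * (suc k ! * suc l !)                             ≡⟨ choose-! (suc k) (suc l) (trans (+-interchange 1 1 k l) (cong (2 +_) k+l≡n)) ⟩
    (2 + n) * ((1 + n) * n !)                       ≡⟨ ℕₚ.*-assoc (2 + n) (1 + n) (n !) ⟨
    (2 + n) * (1 + n) * n !                         ≡⟨ cong ((2 + n) * (1 + n) *_) (choose-! k l k+l≡n) ⟨
    (2 + n) * (1 + n) * ((n C k) * (k ! * l !)) ≡⟨ ℕₚ.*-assoc ((2 + n) * (1 + n)) (n C k) (k ! * l !) ⟨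
    (2 + n) * (1 + n) * (n C k) * (k ! * l !)   ∎)
    where
    open ≡-Reasoning
    c = (2 + n) C suc k
    rearrange : ∀ x y c p q → x * y * c * (p * q) ≡ c * (x * p * (y * q))
    rearrange = ℕ-solve-∀
    instance
      _ = k !* l !≢0

  -- Counts for small peak sets

  -- Cutting after the first letter leaves two parts without peaks. Position 1 is never a peak, so
  -- `{2}` is the only unknown in the cut identity.
  count-2 : ∀ n → count (2 ∷ []) (2 + n) ≡ n * 2 ^ n
  count-2 n = ℕₚ.+-cancelˡ-≡ (2 ^ suc n) _ _ (begin
    2 ^ suc n + count (2 ∷ []) (2 + n)
      ≡⟨ cong (_+ count (2 ∷ []) (2 + n)) (trans (sym (ℕₚ.+-identityʳ _))
           (sym (cong₂ _+_ (count-∅ (suc n)) (count-low [] (2 + n) (s≤s (s≤s z≤n)))))) ⟩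
    count [] (2 + n) + count (1 ∷ []) (2 + n) + count (2 ∷ []) (2 + n)
      ≡⟨ count-split 1 (suc n) refl refl [] [] ⟨
    ((2 + n) C 1) * (count [] 1 * count [] (suc n))
      ≡⟨ cong₂ _*_ (nC1≡n (2 + n)) (cong (1 *_) (count-∅ n)) ⟩
    (2 + n) * (1 * 2 ^ n)
      ≡⟨ expand n (2 ^ n) ⟩
    2 ^ suc n + n * 2 ^ n ∎)
    where
    open ≡-Reasoning
    expand : ∀ n p → (2 + n) * (1 * p) ≡ 2 * p + n * p
    expand = ℕ-solve-∀

  -- The mirror image of `count-2`: the cut is in front of the last letter, and the last position is
  -- never a peak.
  count-last : ∀ n → count (suc n ∷ []) (2 + n) ≡ n * 2 ^ n
  count-last n = ℕₚ.+-cancelˡ-≡ (2 ^ suc n) _ _ (begin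
    2 ^ suc n + c
      ≡⟨ trans (cong (_+ c) (sym (count-∅ (suc n)))) (sym (ℕₚ.+-identityʳ _)) ⟩
    count [] N + c + 0
      ≡⟨ cong (count [] N + c +_) (count-high [] {N} N ℕₚ.≤-refl) ⟨
    count [] N + c + count (N ∷ []) N
      ≡⟨ count-split (suc n) 1 (ℕₚ.+-comm (suc n) 1) refl [] [] ⟨
    (N C suc n) * (count [] (suc n) * 1)
      ≡⟨ cong₂ _*_ ([1+n]Cn≡1+n (suc n)) (cong (_* 1) (count-∅ n)) ⟩
    N * (2 ^ n * 1)
      ≡⟨ expand n (2 ^ n) ⟩
    2 ^ suc n + n * 2 ^ n ∎)
    where
    open ≡-Reasoning
    N = 2 + n
    c = count (suc n ∷ []) N
    expand : ∀ n p → (2 + n) * (p * 1) ≡ 2 * p + n * p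
    expand = ℕ-solve-∀

  count-2-last : ∀ n → count (2 ∷ 3 + n ∷ []) (4 + n) ≡ 2 ^ suc n * ((3 + n) * n)
  count-2-last n = ℕₚ.+-cancelˡ-≡ (count (2 ∷ []) N) _ _ (begin
    count (2 ∷ []) N + c
      ≡⟨ ℕₚ.+-identityʳ _ ⟨
    count (2 ∷ []) N + c + 0
      ≡⟨ cong (count (2 ∷ []) N + c +_) (count-high (2 ∷ []) {N} N ℕₚ.≤-refl) ⟨
    count (2 ∷ []) N + c + count (2 ∷ N ∷ []) N
      ≡⟨ count-split (3 + n) 1 (ℕₚ.+-comm (3 + n) 1) refl (s≤s (s≤s (s≤s z≤n)) ∷ []) [] ⟨
    (N C (3 + n)) * (count (2 ∷ []) (3 + n) * 1)
      ≡⟨ cong₂ _*_ ([1+n]Cn≡1+n (3 + n)) (cong (_* 1) (count-2 (suc n))) ⟩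
    N * (suc n * 2 ^ suc n * 1)
      ≡⟨ expand n (2 ^ suc n) ⟩
    (2 + n) * 2 ^ (2 + n) + 2 ^ suc n * ((3 + n) * n)
      ≡⟨ cong (_+ 2 ^ suc n * ((3 + n) * n)) (count-2 (2 + n)) ⟨
    count (2 ∷ []) N + 2 ^ suc n * ((3 + n) * n) ∎)
    where
    open ≡-Reasoning
    N = 4 + n
    c = count (2 ∷ 3 + n ∷ []) N
    expand : ∀ n p → (4 + n) * ((1 + n) * p * 1) ≡ (2 + n) * (2 * p) + p * ((3 + n) * n)
    expand = ℕ-solve-∀

  -- In closed form, count {2, k, n−1} n = 2ⁿ⁻⁴ (n(n−1) C(n−3,k−2) − 2(n−2) C(n−1,k−1) − (n−1)(n−4)),
  -- where k = i + 3 and n = s + 6; the subtracted terms are moved to the left.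
  count-2-mid-last : ∀ i j {s} → i + j ≡ s →
    count (2 ∷ 3 + i ∷ 5 + s ∷ []) (6 + s) +
      2 ^ (2 + s) * (2 * (4 + s) * ((5 + s) C (2 + i)) + (5 + s) * (2 + s)) ≡
    2 ^ (2 + s) * ((6 + s) * (5 + s) * ((3 + s) C suc i))
  count-2-mid-last zero s refl = begin
    count (2 ∷ 3 ∷ 5 + s ∷ []) (6 + s) + p * (2 * (4 + s) * c + (5 + s) * (2 + s))
      ≡⟨ cong (_+ p * (2 * (4 + s) * c + (5 + s) * (2 + s))) (count-adjacent [] (5 + s ∷ []) (6 + s)) ⟩
    p * (2 * (4 + s) * c + (5 + s) * (2 + s))
      ≡⟨ collect p s c ⟩
    p * ((4 + s) * (2 * c) + (5 + s) * (2 + s))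
      ≡⟨ cong (λ t → p * ((4 + s) * t + (5 + s) * (2 + s))) 2c ⟩
    p * ((4 + s) * ((5 + s) * (4 + s)) + (5 + s) * (2 + s))
      ≡⟨ factor p s ⟩
    p * ((6 + s) * (5 + s) * (3 + s))
      ≡⟨ cong (λ t → p * ((6 + s) * (5 + s) * t)) (nC1≡n (3 + s)) ⟨
    p * ((6 + s) * (5 + s) * ((3 + s) C 1)) ∎
    where
    open ≡-Reasoning
    p = 2 ^ (2 + s)
    c = (5 + s) C 2
    collect : ∀ p s c → p * (2 * (4 + s) * c + (5 + s) * (2 + s)) ≡ p * ((4 + s) * (2 * c) + (5 + s) * (2 + s))
    collect = ℕ-solve-∀
    factor : ∀ p s → p * ((4 + s) * ((5 + s) * (4 + s)) + (5 + s) * (2 + s)) ≡ p * ((6 + s) * (5 + s) * (3 + s))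
    factor = ℕ-solve-∀
    swapʳ : ∀ x y z → x * y * z ≡ x * z * y
    swapʳ = ℕ-solve-∀
    2c : 2 * c ≡ (5 + s) * (4 + s)
    2c = ℕₚ.*-cancelʳ-≡ _ _ (3 + s) (begin
      2 * c * (3 + s)                           ≡⟨ swapʳ 2 c (3 + s) ⟩
      2 * (3 + s) * c                           ≡⟨ choose-absorb 1 (2 + s) refl ⟩
      (5 + s) * (4 + s) * ((3 + s) C 1)     ≡⟨ cong ((5 + s) * (4 + s) *_) (nC1≡n (3 + s)) ⟩
      (5 + s) * (4 + s) * (3 + s)           ∎)
  -- The induction hypothesis, taken at the same `n`, is added to the goal. This produces the sum of
  -- the counts for `k` and `k + 1`, with `k = 3 + i`, which the cut after `k` letters evaluates.
  count-2-mid-last (suc i) j refl = ℕₚ.+-cancelʳ-≡ (p * B₀ + e) _ _ (begin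
    x₁ + p * A₁ + (p * B₀ + e)
      ≡⟨ cong (λ t → x₁ + p * A₁ + (t + e)) (count-2-mid-last i (suc j) (ℕₚ.+-suc i j)) ⟨
    x₁ + p * A₁ + (x₀ + p * A₀ + e)
      ≡⟨ collect x₁ (p * A₁) x₀ (p * A₀) e ⟩
    e + x₀ + x₁ + (p * A₀ + p * A₁)
      ≡⟨ cong (_+ (p * A₀ + p * A₁)) split ⟨
    (N C (3 + i)) * (suc i * (2 + j) * p) + (p * A₀ + p * A₁)
      ≡⟨ cong (λ t → t * (suc i * (2 + j) * p) + (p * A₀ + p * A₁)) (nCk+nC[k+1]≡[n+1]C[k+1] (5 + s) (2 + i)) ⟨
    (c₀ + c₁) * (suc i * (2 + j) * p) + (p * A₀ + p * A₁)
      -- The coefficient `2(n−2)` of the closed form is explained by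
      -- `(k−2)(n−k−2) + 2(n−2) = k(n−k)`. The two copies of `f` will match the count of `{2, n−1}`.
      ≡⟨ combine i j p c₀ c₁ f ⟩
    p * ((3 + i) * (4 + j) * (c₀ + c₁)) + 2 * p * f
      ≡⟨ cong (λ t → p * t + 2 * p * f) absorb ⟩
    p * (g * (d₀ + d₁)) + 2 * p * f
      ≡⟨ separate p g d₀ d₁ f ⟩
    p * (g * d₁) + (p * B₀ + 2 * p * f)
      ≡⟨ cong (λ t → p * (g * d₁) + (p * B₀ + t)) (count-2-last (2 + s)) ⟨
    p * (g * d₁) + (p * B₀ + e) ∎)
    where
    open ≡-Reasoning
    s  = suc i + j
    N  = 6 + s
    p  = 2 ^ (2 + s)
    e  = count (2 ∷ 5 + s ∷ []) N
    x₀ = count (2 ∷ 3 + i ∷ 5 + s ∷ []) N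
    x₁ = count (2 ∷ 4 + i ∷ 5 + s ∷ []) N
    c₀ = (5 + s) C (2 + i)
    c₁ = (5 + s) C (3 + i)
    d₀ = (3 + s) C (1 + i)
    d₁ = (3 + s) C (2 + i)
    f  = (5 + s) * (2 + s)
    g  = (6 + s) * (5 + s)
    A₀ = 2 * (4 + s) * c₀ + f
    A₁ = 2 * (4 + s) * c₁ + f
    B₀ = g * d₀

    collect : ∀ x y z w e → x + y + (z + w + e) ≡ e + z + x + (w + y)
    collect = ℕ-solve-∀

    combine : ∀ i j p c₀ c₁ f →
      (c₀ + c₁) * ((1 + i) * (2 + j) * p) +
        (p * (2 * (5 + (i + j)) * c₀ + f) + p * (2 * (5 + (i + j)) * c₁ + f)) ≡
      p * ((3 + i) * (4 + j) * (c₀ + c₁)) + 2 * p * f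
    combine = ℕ-solve-∀

    separate : ∀ p g d₀ d₁ f → p * (g * (d₀ + d₁)) + 2 * p * f ≡ p * (g * d₁) + (p * (g * d₀) + 2 * p * f)
    separate = ℕ-solve-∀

    powers : ∀ x y p q → x * p * (y * q) ≡ x * y * (p * q)
    powers = ℕ-solve-∀

    split : (N C (3 + i)) * (suc i * (2 + j) * p) ≡ e + x₀ + x₁
    split = begin
      (N C (3 + i)) * (suc i * (2 + j) * p)
        ≡⟨ cong (λ t → (N C (3 + i)) * (suc i * (2 + j) * t))
             (trans (cong (2 ^_) (sym (+-interchange 1 2 i j))) (ℕₚ.^-distribˡ-+-* 2 (suc i) (2 + j))) ⟩
      (N C (3 + i)) * (suc i * (2 + j) * (2 ^ suc i * 2 ^ (2 + j)))
        ≡⟨ cong ((N C (3 + i)) *_) (powers (suc i) (2 + j) (2 ^ suc i) (2 ^ (2 + j))) ⟨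
      (N C (3 + i)) * (suc i * 2 ^ suc i * ((2 + j) * 2 ^ (2 + j)))
        ≡⟨ cong ((N C (3 + i)) *_) (cong₂ _*_ (count-2 (suc i)) (count-last (2 + j))) ⟨
      (N C (3 + i)) * (count (2 ∷ []) (3 + i) * count (3 + j ∷ []) (4 + j))
        ≡⟨ count-split (3 + i) (4 + j) (+-interchange 3 4 i j) (cong (_∷ []) (+-interchange 3 3 i j))
             (s≤s (s≤s (s≤s z≤n)) ∷ []) (s≤s (s≤s z≤n) ∷ []) ⟩
      e + x₀ + x₁ ∎

    -- With `k = 3 + i` this is `k(n−k) C(n,k) = n(n−1) C(n−2,k−1)`, with Pascal's rule on both
    -- sides. It yields the leading terms of the closed form at `k` and `k + 1`.
    absorb : (3 + i) * (4 + j) * (c₀ + c₁) ≡ g * (d₀ + d₁)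
    absorb = begin
      (3 + i) * (4 + j) * (c₀ + c₁)
        ≡⟨ cong ((3 + i) * (4 + j) *_) (nCk+nC[k+1]≡[n+1]C[k+1] (5 + s) (2 + i)) ⟩
      (3 + i) * (4 + j) * (N C (3 + i))
        ≡⟨ choose-absorb (2 + i) (3 + j) (+-interchange 2 3 i j) ⟩
      g * ((4 + s) C (2 + i))
        ≡⟨ cong (g *_) (nCk+nC[k+1]≡[n+1]C[k+1] (3 + s) (1 + i)) ⟨
      g * (d₀ + d₁) ∎

  -- Multiplied by (m+1)! (n−m)!, every binomial coefficient becomes a polynomial multiple of (n−3)!, where m = a + 4 and n = s + 9.
  binomial-identity : ∀ a b {s} → a + b ≡ s →
    (1 + a) * (1 + b) * ((4 + a) * ((8 + s) C (5 + a)) + (4 + b) * ((8 + s) C (3 + a))) +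
    (8 + s) * ((4 + a) * (1 + a) * ((7 + s) C (5 + a)) + (4 + b) * (1 + b) * ((7 + s) C (2 + a))) +
    4 * ((9 + s) * (8 + s) * ((6 + s) C (2 + a))) ≡
    (8 + s) * (2 * (3 + s) * ((6 + s) C (3 + a))) +
    2 * ((4 + a) * (1 + a) * (2 + b) * ((9 + s) C (5 + a))) +
    8 * ((7 + s) * ((8 + s) C (3 + a)))
  binomial-identity a b refl = ℕₚ.*-cancelʳ-≡ (lhs c₁ c₂ c₃ c₄ c₅) (rhs c₆ c₇ c₂) D (begin
    lhs c₁ c₂ c₃ c₄ c₅ * D
      ≡⟨ distribˡ a b s c₁ c₂ c₃ c₄ c₅ D ⟩
    lhs (c₁ * D) (c₂ * D) (c₃ * D) (c₄ * D) (c₅ * D)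
      ≡⟨ lhs-cong c₁D c₂D c₃D c₄D c₅D ⟩
    _ ≡⟨ polynomial a b F ⟩
    _ ≡⟨ rhs-cong c₆D c₇D c₂D ⟨
    rhs (c₆ * D) (c₇ * D) (c₂ * D)
      ≡⟨ distribʳ a b s c₆ c₇ c₂ D ⟨
    rhs c₆ c₇ c₂ * D ∎)
    where
    open ≡-Reasoning
    s  = a + b
    D  = (5 + a) ! * (5 + b) !
    F  = (6 + s) !
    c₁ = (8 + s) C (5 + a)
    c₂ = (8 + s) C (3 + a)
    c₃ = (7 + s) C (5 + a)
    c₄ = (7 + s) C (2 + a)
    c₅ = (6 + s) C (2 + a)
    c₆ = (6 + s) C (3 + a)
    c₇ = (9 + s) C (5 + a)

    lhs : ℕ → ℕ → ℕ → ℕ → ℕ → ℕ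
    lhs x₁ x₂ x₃ x₄ x₅ =
      (1 + a) * (1 + b) * ((4 + a) * x₁ + (4 + b) * x₂) +
      (8 + s) * ((4 + a) * (1 + a) * x₃ + (4 + b) * (1 + b) * x₄) +
      4 * ((9 + s) * (8 + s) * x₅)

    rhs : ℕ → ℕ → ℕ → ℕ
    rhs x₆ x₇ x₂ =
      (8 + s) * (2 * (3 + s) * x₆) +
      2 * ((4 + a) * (1 + a) * (2 + b) * x₇) +
      8 * ((7 + s) * x₂)

    lhs-cong : ∀ {x₁ x₂ x₃ x₄ x₅ y₁ y₂ y₃ y₄ y₅} → x₁ ≡ y₁ → x₂ ≡ y₂ → x₃ ≡ y₃ → x₄ ≡ y₄ → x₅ ≡ y₅ →
      lhs x₁ x₂ x₃ x₄ x₅ ≡ lhs y₁ y₂ y₃ y₄ y₅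
    lhs-cong refl refl refl refl refl = refl

    rhs-cong : ∀ {x₁ x₂ x₃ y₁ y₂ y₃} → x₁ ≡ y₁ → x₂ ≡ y₂ → x₃ ≡ y₃ → rhs x₁ x₂ x₃ ≡ rhs y₁ y₂ y₃
    rhs-cong refl refl refl = refl

    distribˡ : ∀ a b s x₁ x₂ x₃ x₄ x₅ D →
      ((1 + a) * (1 + b) * ((4 + a) * x₁ + (4 + b) * x₂) +
      (8 + s) * ((4 + a) * (1 + a) * x₃ + (4 + b) * (1 + b) * x₄) +
      4 * ((9 + s) * (8 + s) * x₅)) * D ≡
      (1 + a) * (1 + b) * ((4 + a) * (x₁ * D) + (4 + b) * (x₂ * D)) +
      (8 + s) * ((4 + a) * (1 + a) * (x₃ * D) + (4 + b) * (1 + b) * (x₄ * D)) +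
      4 * ((9 + s) * (8 + s) * (x₅ * D))
    distribˡ = ℕ-solve-∀

    distribʳ : ∀ a b s x₆ x₇ x₂ D →
      ((8 + s) * (2 * (3 + s) * x₆) +
      2 * ((4 + a) * (1 + a) * (2 + b) * x₇) +
      8 * ((7 + s) * x₂)) * D ≡
      (8 + s) * (2 * (3 + s) * (x₆ * D)) +
      2 * ((4 + a) * (1 + a) * (2 + b) * (x₇ * D)) +
      8 * ((7 + s) * (x₂ * D))
    distribʳ = ℕ-solve-∀

    -- The two subscripts tell how many factors are peeled off `(5 + a) !` and `(5 + b) !`, so that
    -- what is left are the factorials belonging to the given binomial coefficient.
    scale₂₀ : ∀ c p q x y → c * (x * (y * p) * q) ≡ x * y * (c * (p * q))
    scale₂₀ = ℕ-solve-∀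
    scale₀₂ : ∀ c p q x y → c * (p * (x * (y * q))) ≡ x * y * (c * (p * q))
    scale₀₂ = ℕ-solve-∀
    scale₃₀ : ∀ c p q x y z → c * (x * (y * (z * p)) * q) ≡ x * y * z * (c * (p * q))
    scale₃₀ = ℕ-solve-∀
    scale₀₃ : ∀ c p q x y z → c * (p * (x * (y * (z * q)))) ≡ x * y * z * (c * (p * q))
    scale₀₃ = ℕ-solve-∀
    scale₃₁ : ∀ c p q x y z w → c * (x * (y * (z * p)) * (w * q)) ≡ x * y * z * w * (c * (p * q))
    scale₃₁ = ℕ-solve-∀
    scale₂₂ : ∀ c p q x y z w → c * (x * (y * p) * (z * (w * q))) ≡ x * y * z * w * (c * (p * q))
    scale₂₂ = ℕ-solve-∀
    scale₀₁ : ∀ c p q x → c * (p * (x * q)) ≡ x * (c * (p * q))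
    scale₀₁ = ℕ-solve-∀

    c₁D : c₁ * D ≡ (5 + b) * (4 + b) * ((8 + s) * ((7 + s) * F))
    c₁D = trans (scale₀₂ c₁ ((5 + a) !) ((3 + b) !) (5 + b) (4 + b))
      (cong ((5 + b) * (4 + b) *_) (choose-! (5 + a) (3 + b) (+-interchange 5 3 a b)))

    c₂D : c₂ * D ≡ (5 + a) * (4 + a) * ((8 + s) * ((7 + s) * F))
    c₂D = trans (scale₂₀ c₂ ((3 + a) !) ((5 + b) !) (5 + a) (4 + a))
      (cong ((5 + a) * (4 + a) *_) (choose-! (3 + a) (5 + b) (+-interchange 3 5 a b)))

    c₃D : c₃ * D ≡ (5 + b) * (4 + b) * (3 + b) * ((7 + s) * F)
    c₃D = trans (scale₀₃ c₃ ((5 + a) !) ((2 + b) !) (5 + b) (4 + b) (3 + b))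
      (cong ((5 + b) * (4 + b) * (3 + b) *_) (choose-! (5 + a) (2 + b) (+-interchange 5 2 a b)))

    c₄D : c₄ * D ≡ (5 + a) * (4 + a) * (3 + a) * ((7 + s) * F)
    c₄D = trans (scale₃₀ c₄ ((2 + a) !) ((5 + b) !) (5 + a) (4 + a) (3 + a))
      (cong ((5 + a) * (4 + a) * (3 + a) *_) (choose-! (2 + a) (5 + b) (+-interchange 2 5 a b)))

    c₅D : c₅ * D ≡ (5 + a) * (4 + a) * (3 + a) * (5 + b) * F
    c₅D = trans (scale₃₁ c₅ ((2 + a) !) ((4 + b) !) (5 + a) (4 + a) (3 + a) (5 + b))
      (cong ((5 + a) * (4 + a) * (3 + a) * (5 + b) *_) (choose-! (2 + a) (4 + b) (+-interchange 2 4 a b)))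

    c₆D : c₆ * D ≡ (5 + a) * (4 + a) * (5 + b) * (4 + b) * F
    c₆D = trans (scale₂₂ c₆ ((3 + a) !) ((3 + b) !) (5 + a) (4 + a) (5 + b) (4 + b))
      (cong ((5 + a) * (4 + a) * (5 + b) * (4 + b) *_) (choose-! (3 + a) (3 + b) (+-interchange 3 3 a b)))

    c₇D : c₇ * D ≡ (5 + b) * ((9 + s) * ((8 + s) * ((7 + s) * F)))
    c₇D = trans (scale₀₁ c₇ ((5 + a) !) ((4 + b) !) (5 + b))
      (cong ((5 + b) *_) (choose-! (5 + a) (4 + b) (+-interchange 5 4 a b)))

    polynomial : ∀ a b F → let s = a + b in
      (1 + a) * (1 + b) * ((4 + a) * ((5 + b) * (4 + b) * ((8 + s) * ((7 + s) * F))) +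
        (4 + b) * ((5 + a) * (4 + a) * ((8 + s) * ((7 + s) * F)))) +
      (8 + s) * ((4 + a) * (1 + a) * ((5 + b) * (4 + b) * (3 + b) * ((7 + s) * F)) +
        (4 + b) * (1 + b) * ((5 + a) * (4 + a) * (3 + a) * ((7 + s) * F))) +
      4 * ((9 + s) * (8 + s) * ((5 + a) * (4 + a) * (3 + a) * (5 + b) * F)) ≡
      (8 + s) * (2 * (3 + s) * ((5 + a) * (4 + a) * (5 + b) * (4 + b) * F)) +
      2 * ((4 + a) * (1 + a) * (2 + b) * ((5 + b) * ((9 + s) * ((8 + s) * ((7 + s) * F))))) +
      8 * ((7 + s) * ((5 + a) * (4 + a) * ((8 + s) * ((7 + s) * F))))
    polynomial = ℕ-solve-∀

    instance
      _ = (5 + a) !* (5 + b) !≢0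

  -- The peak set {2, m, m+2, n-1}

  -- The cut after `m + 1` letters gives both parts a closed form: `m` is the last possible peak of
  -- the prefix, and `3 + b = n − m − 2` is the last possible peak of the suffix.
  count-2-mids-last : ∀ a b {s} → a + b ≡ s →
    count (2 ∷ 4 + a ∷ 8 + s ∷ []) (9 + s) + count (2 ∷ 4 + a ∷ 6 + a ∷ 8 + s ∷ []) (9 + s) ≡
      2 ^ (4 + s) * ((4 + a) * (1 + a) * (2 + b) * ((9 + s) C (5 + a)))
  count-2-mids-last a b refl = begin
    X + Y
      ≡⟨ cong (_+ Y) (trans (cong (X +_) (count-adjacent (2 ∷ []) (8 + s ∷ []) N)) (ℕₚ.+-identityʳ X)) ⟨
    X + count (2 ∷ 4 + a ∷ 5 + a ∷ 8 + s ∷ []) N + Y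
      ≡⟨ count-split (5 + a) (4 + b) {S₁ = 2 ∷ 4 + a ∷ []} {S₂ = 3 + b ∷ []} (+-interchange 5 4 a b) (cong (_∷ []) (+-interchange 5 3 a b))
           (s≤s (s≤s (s≤s z≤n)) ∷ ℕₚ.≤-refl ∷ []) (s≤s (s≤s z≤n) ∷ []) ⟨
    c * (count (2 ∷ 4 + a ∷ []) (5 + a) * count (3 + b ∷ []) (4 + b))
      ≡⟨ cong (c *_) (cong₂ _*_ (count-2-last (suc a)) (count-last (2 + b))) ⟩
    c * (2 ^ (2 + a) * ((4 + a) * (1 + a)) * ((2 + b) * 2 ^ (2 + b)))
      ≡⟨ rearrange c (2 ^ (2 + a)) (2 ^ (2 + b)) ((4 + a) * (1 + a)) (2 + b) ⟩
    2 ^ (2 + a) * 2 ^ (2 + b) * e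
      ≡⟨ cong (_* e) (trans (sym (ℕₚ.^-distribˡ-+-* 2 (2 + a) (2 + b))) (cong (2 ^_) (+-interchange 2 2 a b))) ⟩
    2 ^ (4 + s) * e ∎
    where
    open ≡-Reasoning
    s = a + b
    N = 9 + s
    X = count (2 ∷ 4 + a ∷ 8 + s ∷ []) N
    Y = count (2 ∷ 4 + a ∷ 6 + a ∷ 8 + s ∷ []) N
    c = N C (5 + a)
    e = (4 + a) * (1 + a) * (2 + b) * c
    rearrange : ∀ c p q x y → c * (p * x * (y * q)) ≡ p * q * (x * y * c)
    rearrange = ℕ-solve-∀

  -- The count `X` of `{2, m, n−1}` is eliminated by adding twice its closed form. The two terms
  -- with `2(n−6)` merge by Pascal's rule into one with `C(n−3,m−1)`, and the summand `4 C(n−4,1)`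
  -- stems from the term `(n−1)(n−4)` of that closed form. The rest is `binomial-identity`.
  2*count-2-mids-last : ∀ a b {s} → a + b ≡ s →
    2 * count (2 ∷ 4 + a ∷ 6 + a ∷ 8 + s ∷ []) (9 + s) +
      (8 + s) * (2 * (3 + s) * ((5 + s) C (3 + a)) + 2 * (3 + s) * ((5 + s) C (2 + a))) * 2 ^ (4 + s) ≡
    ((1 + a) * (1 + b) * ((4 + a) * ((8 + s) C (5 + a)) + (4 + b) * ((8 + s) C (3 + a))) +
     (8 + s) * ((4 + a) * (1 + a) * ((7 + s) C (5 + a)) + (4 + b) * (1 + b) * ((7 + s) C (2 + a)) + 4 * ((5 + s) C 1))) *
      2 ^ (4 + s)
  2*count-2-mids-last a b {s} a+b≡s = ℕₚ.+-cancelʳ-≡ (2 * (X + 2 * q * K)) _ _ (begin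
    2 * Y + (8 + s) * (2 * (3 + s) * c₅ + 2 * (3 + s) * c₆) * q + 2 * (X + 2 * q * K)
      ≡⟨ collect Y X (8 + s) (3 + s) c₅ c₆ q K ⟩
    2 * (X + Y) + ((8 + s) * (2 * (3 + s) * (c₆ + c₅)) * q + 4 * q * K)
      ≡⟨ cong₂ (λ x y → 2 * x + ((8 + s) * (2 * (3 + s) * y) * q + 4 * q * K))
           (count-2-mids-last a b a+b≡s) (nCk+nC[k+1]≡[n+1]C[k+1] (5 + s) (2 + a)) ⟩
    2 * (q * E) + ((8 + s) * (2 * (3 + s) * c₉) * q + 4 * q * K)
      ≡⟨ factor q E ((8 + s) * (2 * (3 + s) * c₉)) (7 + s) c₂ (8 + s) (5 + s) ⟩
    q * (((8 + s) * (2 * (3 + s) * c₉) + 2 * E + 8 * ((7 + s) * c₂)) + (8 + s) * (4 * (5 + s)))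
      ≡⟨ cong (λ t → q * (t + (8 + s) * (4 * (5 + s)))) (binomial-identity a b a+b≡s) ⟨
    q * ((L + (8 + s) * M + 4 * H) + (8 + s) * (4 * (5 + s)))
      ≡⟨ expand q L (8 + s) M H (5 + s) ⟩
    (L + (8 + s) * (M + 4 * (5 + s))) * q + 2 * (2 * q * H)
      ≡⟨ cong₂ (λ x y → (L + (8 + s) * (M + 4 * x)) * q + 2 * y) (nC1≡n (5 + s))
           (count-2-mid-last (1 + a) (2 + b) (trans (+-interchange 1 2 a b) (cong (3 +_) a+b≡s))) ⟨
    (L + (8 + s) * (M + 4 * ((5 + s) C 1))) * q + 2 * (X + 2 * q * K) ∎)
    where
    open ≡-Reasoning
    q  = 2 ^ (4 + s)
    X  = count (2 ∷ 4 + a ∷ 8 + s ∷ []) (9 + s)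
    Y  = count (2 ∷ 4 + a ∷ 6 + a ∷ 8 + s ∷ []) (9 + s)
    c₂ = (8 + s) C (3 + a)
    c₅ = (5 + s) C (3 + a)
    c₆ = (5 + s) C (2 + a)
    c₉ = (6 + s) C (3 + a)
    K  = 2 * (7 + s) * c₂ + (8 + s) * (5 + s)
    H  = (9 + s) * (8 + s) * ((6 + s) C (2 + a))
    E  = (4 + a) * (1 + a) * (2 + b) * ((9 + s) C (5 + a))
    L  = (1 + a) * (1 + b) * ((4 + a) * ((8 + s) C (5 + a)) + (4 + b) * c₂)
    M  = (4 + a) * (1 + a) * ((7 + s) C (5 + a)) + (4 + b) * (1 + b) * ((7 + s) C (2 + a))

    collect : ∀ Y X u v c₅ c₆ q K →
      2 * Y + u * (2 * v * c₅ + 2 * v * c₆) * q + 2 * (X + 2 * q * K) ≡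
      2 * (X + Y) + (u * (2 * v * (c₆ + c₅)) * q + 4 * q * K)
    collect = ℕ-solve-∀

    factor : ∀ q E G t c u w →
      2 * (q * E) + (G * q + 4 * q * (2 * t * c + u * w)) ≡
      q * ((G + 2 * E + 8 * (t * c)) + u * (4 * w))
    factor = ℕ-solve-∀

    expand : ∀ q L u M H w →
      q * ((L + u * M + 4 * H) + u * (4 * w)) ≡
      (L + u * (M + 4 * w)) * q + 2 * (2 * q * H)
    expand = ℕ-solve-∀

-- Transfer to the integers

open PeakCounts
open import Data.Integer using (ℤ; +_; _+_; _*_; _-_; _^_)
import Data.Integer.Properties as ℤₚ
open import Data.Integer.Tactic.RingSolver using () renaming (solve-∀ to ℤ-solve-∀)

infixl 7 _⊗_
infixl 6 _⊕_

-- Together with `_⊕_` this lets a cast equation for a large expression be written in the shape of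
-- the expression itself, with the natural number on the right inferred.
_⊗_ : ∀ {i j m n} → i ≡ + m → j ≡ + n → i * j ≡ + (m ℕ.* n)
_⊗_ {m = m} {n} refl refl = sym (ℤₚ.pos-* m n)

_⊕_ : ∀ {i j m n} → i ≡ + m → j ≡ + n → i + j ≡ + (m ℕ.+ n)
refl ⊕ refl = refl

pos-2^ : ∀ n → (+ 2) ^ n ≡ + (2 ℕ.^ n)
pos-2^ zero    = refl
pos-2^ (suc n) = refl {x = + 2} ⊗ pos-2^ n

-- Both sides of the equation over ℕ are subtraction-free and cast termwise; the terms with `c₅` and
-- `c₆` cross over only after the cast. The binomial coefficients are abstracted to variables, which
-- leaves a pure ring identity.
ℕ⇒ℤ : ∀ Y x y z m u v k c₁ c₂ c₃ c₄ c₅ c₆ c₇ →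
  2 ℕ.* Y ℕ.+ u ℕ.* (2 ℕ.* v ℕ.* c₅ ℕ.+ 2 ℕ.* v ℕ.* c₆) ℕ.* 2 ℕ.^ k ≡
  (x ℕ.* y ℕ.* (m ℕ.* c₁ ℕ.+ z ℕ.* c₂) ℕ.+ u ℕ.* (m ℕ.* x ℕ.* c₃ ℕ.+ z ℕ.* y ℕ.* c₄ ℕ.+ 4 ℕ.* c₇)) ℕ.* 2 ℕ.^ k →
  (+ 2) * (+ Y) ≡
  ((+ x) * (+ y) * ((+ m) * (+ c₁) + (+ z) * (+ c₂)) +
   (+ u) * ((+ m) * (+ x) * (+ c₃) + (+ z) * (+ y) * (+ c₄) - (+ 2) * (+ v) * (+ c₅) - (+ 2) * (+ v) * (+ c₆) + (+ 4) * (+ c₇))) * (+ 2) ^ k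
ℕ⇒ℤ Y x y z m u v k c₁ c₂ c₃ c₄ c₅ c₆ c₇ eq = begin
  (+ 2) * (+ Y)
    ≡⟨ add-sub ((+ 2) * (+ Y)) (negative * (+ 2) ^ k) ⟩
  (+ 2) * (+ Y) + negative * (+ 2) ^ k - negative * (+ 2) ^ k
    ≡⟨ cong (_- negative * (+ 2) ^ k) (trans castˡ (trans (cong +_ eq) (sym castʳ))) ⟩
  positive * (+ 2) ^ k - negative * (+ 2) ^ k
    ≡⟨ distrib (+ x) (+ y) (+ z) (+ m) (+ u) (+ v) ((+ 2) ^ k) (+ c₁) (+ c₂) (+ c₃) (+ c₄) (+ c₅) (+ c₆) (+ c₇) ⟩
  _ ∎
  where
  open ≡-Reasoning
  positive = (+ x) * (+ y) * ((+ m) * (+ c₁) + (+ z) * (+ c₂)) + (+ u) * ((+ m) * (+ x) * (+ c₃) + (+ z) * (+ y) * (+ c₄) + (+ 4) * (+ c₇))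
  negative = (+ u) * ((+ 2) * (+ v) * (+ c₅) + (+ 2) * (+ v) * (+ c₆))

  ⌜_⌝ : ∀ n → + n ≡ + n
  ⌜ n ⌝ = refl

  castˡ : (+ 2) * (+ Y) + negative * (+ 2) ^ k ≡ + (2 ℕ.* Y ℕ.+ u ℕ.* (2 ℕ.* v ℕ.* c₅ ℕ.+ 2 ℕ.* v ℕ.* c₆) ℕ.* 2 ℕ.^ k)
  castˡ = ⌜ 2 ⌝ ⊗ ⌜ Y ⌝ ⊕ ⌜ u ⌝ ⊗ (⌜ 2 ⌝ ⊗ ⌜ v ⌝ ⊗ ⌜ c₅ ⌝ ⊕ ⌜ 2 ⌝ ⊗ ⌜ v ⌝ ⊗ ⌜ c₆ ⌝) ⊗ pos-2^ k

  castʳ : positive * (+ 2) ^ k ≡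
    + ((x ℕ.* y ℕ.* (m ℕ.* c₁ ℕ.+ z ℕ.* c₂) ℕ.+ u ℕ.* (m ℕ.* x ℕ.* c₃ ℕ.+ z ℕ.* y ℕ.* c₄ ℕ.+ 4 ℕ.* c₇)) ℕ.* 2 ℕ.^ k)
  castʳ = (⌜ x ⌝ ⊗ ⌜ y ⌝ ⊗ (⌜ m ⌝ ⊗ ⌜ c₁ ⌝ ⊕ ⌜ z ⌝ ⊗ ⌜ c₂ ⌝) ⊕
           ⌜ u ⌝ ⊗ (⌜ m ⌝ ⊗ ⌜ x ⌝ ⊗ ⌜ c₃ ⌝ ⊕ ⌜ z ⌝ ⊗ ⌜ y ⌝ ⊗ ⌜ c₄ ⌝ ⊕ ⌜ 4 ⌝ ⊗ ⌜ c₇ ⌝)) ⊗ pos-2^ k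

  add-sub : ∀ i j → i ≡ i + j - j
  add-sub = ℤ-solve-∀

  distrib : ∀ x y z m u v q c₁ c₂ c₃ c₄ c₅ c₆ c₇ →
    (x * y * (m * c₁ + z * c₂) + u * (m * x * c₃ + z * y * c₄ + (+ 4) * c₇)) * q - u * ((+ 2) * v * c₅ + (+ 2) * v * c₆) * q ≡
    (x * y * (m * c₁ + z * c₂) + u * (m * x * c₃ + z * y * c₄ - (+ 2) * v * c₅ - (+ 2) * v * c₆ + (+ 4) * c₇)) * q
  distrib = ℤ-solve-∀

-- `m + 1`, `m + 2` and `n ∸ m` do not reduce to successor form for variable `m` and `n`. As
-- variables bound by equations they are replaced by such forms, after which every `∸` in the
-- statement computes.
theorem4p4-shifted : ∀ a b {n m+1 m+2 n-m} → let m = 4 ℕ.+ a in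
  n ≡ 9 ℕ.+ (a ℕ.+ b) → m+1 ≡ 5 ℕ.+ a → m+2 ≡ 6 ℕ.+ a → n-m ≡ 5 ℕ.+ b →
  (+ 2) * (+ #P (2 ∷ m ∷ m+2 ∷ (n ℕ.∸ 1) ∷ []) n)
    ≡ ((+ (m ℕ.∸ 3)) * (+ (n-m ℕ.∸ 4)) * ((+ m) * (+ ((n ℕ.∸ 1) C m+1)) + (+ (n-m ℕ.∸ 1)) * (+ ((n ℕ.∸ 1) C (m ℕ.∸ 1))))
      + (+ (n ℕ.∸ 1)) * ((+ m) * (+ (m ℕ.∸ 3)) * (+ ((n ℕ.∸ 2) C m+1))
                       + (+ (n-m ℕ.∸ 1)) * (+ (n-m ℕ.∸ 4)) * (+ ((n ℕ.∸ 2) C (m ℕ.∸ 2)))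
                       - (+ 2) * (+ (n ℕ.∸ 6)) * (+ ((n ℕ.∸ 4) C (m ℕ.∸ 1)))
                       - (+ 2) * (+ (n ℕ.∸ 6)) * (+ ((n ℕ.∸ 4) C (m ℕ.∸ 2)))
                       + (+ 4) * (+ ((n ℕ.∸ 4) C 1))))
      * (+ 2) ^ (n ℕ.∸ 5)
theorem4p4-shifted a b refl refl refl refl = trans
  (cong (λ t → (+ 2) * (+ t)) (#P≡count (2 ∷ 4 ℕ.+ a ∷ 6 ℕ.+ a ∷ 8 ℕ.+ s ∷ []) (9 ℕ.+ s)))
  (ℕ⇒ℤ (count (2 ∷ 4 ℕ.+ a ∷ 6 ℕ.+ a ∷ 8 ℕ.+ s ∷ []) (9 ℕ.+ s))
    (1 ℕ.+ a) (1 ℕ.+ b) (4 ℕ.+ b) (4 ℕ.+ a) (8 ℕ.+ s) (3 ℕ.+ s) (4 ℕ.+ s)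
    ((8 ℕ.+ s) C (5 ℕ.+ a)) ((8 ℕ.+ s) C (3 ℕ.+ a)) ((7 ℕ.+ s) C (5 ℕ.+ a)) ((7 ℕ.+ s) C (2 ℕ.+ a))
    ((5 ℕ.+ s) C (3 ℕ.+ a)) ((5 ℕ.+ s) C (2 ℕ.+ a)) ((5 ℕ.+ s) C 1)
    (2*count-2-mids-last a b refl))
  where
  s = a ℕ.+ b

theorem4p4 : (m n : ℕ) → 4 ≤ m → m ℕ.+ 5 ≤ n →
    (+ 2) * (+ #P (2 ∷ m ∷ (m ℕ.+ 2) ∷ (n ∸ 1) ∷ []) n)
    ≡ ((+ (m ∸ 3)) * (+ (n ∸ m ∸ 4)) * ((+ m) * (+ ((n ∸ 1) C (m ℕ.+ 1))) + (+ (n ∸ m ∸ 1)) * (+ ((n ∸ 1) C (m ∸ 1))))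
    + (+ (n ∸ 1)) * ((+ m) * (+ (m ∸ 3)) * (+ ((n ∸ 2) C (m ℕ.+ 1)))
    + (+ (n ∸ m ∸ 1)) * (+ (n ∸ m ∸ 4)) * (+ ((n ∸ 2) C (m ∸ 2)))
    - (+ 2) * (+ (n ∸ 6)) * (+ ((n ∸ 4) C (m ∸ 1)))
    - (+ 2) * (+ (n ∸ 6)) * (+ ((n ∸ 4) C (m ∸ 2)))
    + (+ 4) * (+ ((n ∸ 4) C 1))))
    * (+ 2) ^ (n ∸ 5)
theorem4p4 (suc (suc (suc (suc a)))) n (s≤s (s≤s (s≤s (s≤s z≤n)))) m+5≤n with ℕₚ.m≤n⇒∃[o]m+o≡n m+5≤n
... | b , m+5+b≡n = theorem4p4-shifted a b
  (trans (sym m+5+b≡n) (reorder a b))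
  (ℕₚ.+-comm (4 ℕ.+ a) 1)
  (ℕₚ.+-comm (4 ℕ.+ a) 2)
  (trans (cong (_∸ (4 ℕ.+ a)) (trans (sym m+5+b≡n) (ℕₚ.+-assoc (4 ℕ.+ a) 5 b))) (ℕₚ.m+n∸m≡n (4 ℕ.+ a) (5 ℕ.+ b)))
  where
  reorder : ∀ a b → 4 ℕ.+ a ℕ.+ 5 ℕ.+ b ≡ 9 ℕ.+ (a ℕ.+ b)
  reorder = ℕ-solve-∀
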